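{- Let $\Gamma$ be a (finite, simple, connected) tetravalent graph of girth $5$. Then $\Gamma$ admits a half-arc-transitive subgroup $G\leq \mathrm{Aut}(\Gamma)$ such that, with respect to a $G$-induced orientation of the edges of $\Gamma$, $\Gamma$ has at least one undirected $5$-cycle, if and only if $\Gamma\cong \mathcal{X}_o(3,9;4)$ (the Doyle-Holt graph) or $\Gamma\cong \mathrm{R}_{12}(5,2)$.
   Context: An arc of a graph is an ordered pair of adjacent vertices. A subgroup $G\le\mathrm{Aut}(\Gamma)$ is half-arc-transitive on $\Gamma$ if it acts transitively on the vertex set and on the edge set but not on the arc set. In that case $G$ has exactly two orbits on arcs, each containing exactly one of $(u,v),(v,u)$ for every edge $\{u,v\}$; each of these orbits, viewed as a set of directed edges, is a $G$-induced orientation $\vec\Gamma$ of $\Gamma$ (in the tetravalent case every vertex has two out-neighbours and two in-neighbours). A $5$-cycle $C$ of $\Gamma$ is directed with respect to $\vec\Gamma$ if every vertex of $C$ is the head of one and the tail of the other of the two arcs of $\vec\Gamma$ corresponding to the two edges of $C$ at that vertex; otherwise it is undirected. (This does not depend on which of the two $G$-induced orientations is chosen.) For integers $m\ge3$ and odd $r\ge3$ and $q\in\mathbb{Z}_r$ with $q^m=\pm1$, the graph $\mathcal{X}_o(m,r;q)$ has vertex set $\{u_i^j: i\in\mathbb{Z}_m, j\in\mathbb{Z}_r\}$ and edges given by $u_i^j\sim u_{i+1}^{j\pm q^i}$ ($i\in\mathbb{Z}_m$, $j\in\mathbb{Z}_r$), subscripts mod $m$, superscripts mod $r$. For $n\ge3$,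 $1\le r<n/2$, $1\le a\le n-1$, the Rose window graph $\mathrm{R}_n(a,r)$ has vertex set $\{x_i,y_i: i\in\mathbb{Z}_n\}$ and edges $\{x_i,x_{i+1}\}$, $\{y_i,y_{i+r}\}$, $\{x_i,y_i\}$, $\{x_i,y_{i-a}\}$ for $i\in\mathbb{Z}_n$ (indices mod $n$). -}

module Defs where

open import Level using (Level; suc; zero)
open import Data.Bool using (Bool; true; false; _∧_; _∨_)
open import Data.Nat using (ℕ; _+_; _∸_; _^_; _%_; _≡ᵇ_; NonZero)
import Data.Nat as ℕ
open import Data.Nat.DivMod using (m%n<n)
open import Data.Fin using (Fin; toℕ; fromℕ<)
open import Data.Product using (Σ; ∃; _×_; _,_)
open import Data.Sum using (_⊎_; inj₁; inj₂)
open import Function using (id; _∘_)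
open import Relation.Nullary using (¬_)
open import Relation.Binary.PropositionalEquality using (_≡_)

record Graph : Set₁ where
  field
    V   : Set
    adj : V → V → Bool

open Graph public

module _ (Γ : Graph) where

  Adj : V Γ → V Γ → Set
  Adj u v = adj Γ u v ≡ true

  IsSimple : Set
  IsSimple = (∀ u v → adj Γ u v ≡ adj Γ v u) × (∀ v → adj Γ v v ≡ false)

  data Walk (u : V Γ) : V Γ → Set where
    here : Walk u u
    step : ∀ {v w} → Walk u v → Adj v w → Walk u w

  Connected : Set
  Connected = ∀ u v → Walk u v

  Tetravalent : Set
  Tetravalent = ∀ v → Σ (Fin 4 → V Γ) λ f →
      (∀ i j → f i ≡ f j → i ≡ j)
    × (∀ i → Adj v (f i))
    × (∀ w → Adj v w → ∃ λ i → f i ≡ w)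

  next : ∀ {k} .{{_ : NonZero k}} → Fin k → Fin k
  next {k} i = fromℕ< (m%n<n (ℕ.suc (toℕ i)) k)

  Cycle : (k : ℕ) .{{_ : NonZero k}} → Set
  Cycle k = Σ (Fin k → V Γ) λ c →
      (∀ i j → c i ≡ c j → i ≡ j)
    × (∀ i → Adj (c i) (c (next i)))

  -- girth 5 (cycles have length ≥ 3): a 5-cycle exists, no 3- or 4-cycles
  Girth5 : Set
  Girth5 = Cycle 5 × ¬ Cycle 3 × ¬ Cycle 4

  IsAut : (V Γ → V Γ) → Set
  IsAut g = (∀ u v → g u ≡ g v → u ≡ v)
          × (∀ w → ∃ λ u → g u ≡ w)
          × (∀ u v → adj Γ (g u) (g v) ≡ adj Γ u v)

  record IsSubgroupOfAut (G : (V Γ → V Γ) → Set) : Set where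
    field
      ext    : ∀ g h → (∀ x → g x ≡ h x) → G g → G h
      aut    : ∀ g → G g → IsAut g
      has-id : G id
      comp   : ∀ g h → G g → G h → G (g ∘ h)
      inv    : ∀ g → G g → ∃ λ h → G h × (∀ x → h (g x) ≡ x)

  module _ (G : (V Γ → V Γ) → Set) where

    VertexTransitive : Set
    VertexTransitive = ∀ u v → ∃ λ g → G g × g u ≡ v

    EdgeTransitive : Set
    EdgeTransitive = ∀ u v x y → Adj u v → Adj x y → ∃ λ g → G g ×
      ((g u ≡ x × g v ≡ y) ⊎ (g u ≡ y × g v ≡ x))

    ArcTransitive : Set
    ArcTransitive = ∀ u v x y → Adj u v → Adj x y → ∃ λ g → G g ×
      (g u ≡ x × g v ≡ y)

    HalfArcTransitive : Set
    HalfArcTransitive = IsSubgroupOfAut G × VertexTransitive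
                      × EdgeTransitive × ¬ ArcTransitive

    -- the G-orbit of the arc (a , b): a G-induced orientation when G is
    -- half-arc-transitive and (a , b) is an arc
    ArcOrbit : V Γ → V Γ → (V Γ → V Γ → Set)
    ArcOrbit a b x y = ∃ λ g → G g × g a ≡ x × g b ≡ y

  DirectedAt : (O : V Γ → V Γ → Set) {k : ℕ} .{{_ : NonZero k}} →
               (Fin k → V Γ) → Fin k → Set
  DirectedAt O c i =
      (O (c i) (c (next i)) × O (c (next i)) (c (next (next i))))
    ⊎ (O (c (next i)) (c i) × O (c (next (next i))) (c (next i)))

  UndirectedCycle : (O : V Γ → V Γ → Set) {k : ℕ} .{{_ : NonZero k}} →
                    Cycle k → Set
  UndirectedCycle O (c , _) = ¬ (∀ i → DirectedAt O c i)

_≅_ : Graph → Graph → Set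
Γ ≅ Δ = Σ (V Γ → V Δ) λ f → Σ (V Δ → V Γ) λ f⁻ →
    (∀ x → f⁻ (f x) ≡ x) × (∀ y → f (f⁻ y) ≡ y)
  × (∀ u v → adj Δ (f u) (f v) ≡ adj Γ u v)

-- X_o(m, r; q): vertices u_i^j = (i , j), edges u_i^j ~ u_{i+1}^{j ± q^i}

Xo : (m r q : ℕ) .{{_ : NonZero m}} .{{_ : NonZero r}} → Graph
Xo m r q = record { V = Fin m × Fin r ; adj = λ { (i , j) (i' , j') →
                      stp i j i' j' ∨ stp i' j' i j } }
  where
  stp : Fin m → Fin r → Fin m → Fin r → Bool
  stp i j i' j' =
    (toℕ i' ≡ᵇ (ℕ.suc (toℕ i)) % m) ∧
    ((toℕ j' ≡ᵇ (toℕ j + q ^ toℕ i) % r) ∨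
     (toℕ j' ≡ᵇ (toℕ j + (r ∸ (q ^ toℕ i % r))) % r))

-- Rose window graph R_n(a, r): x_i = inj₁ i, y_i = inj₂ i
Rose : (n a r : ℕ) .{{_ : NonZero n}} → Graph
Rose n a r = record { V = Fin n ⊎ Fin n ; adj = ad }
  where
  xy : Fin n → Fin n → Bool
  xy i j = (toℕ j ≡ᵇ toℕ i) ∨ (toℕ j ≡ᵇ (toℕ i + (n ∸ a)) % n)
  ad : Fin n ⊎ Fin n → Fin n ⊎ Fin n → Bool
  ad (inj₁ i) (inj₁ j) = (toℕ j ≡ᵇ (toℕ i + 1) % n) ∨ (toℕ i ≡ᵇ (toℕ j + 1) % n)
  ad (inj₂ i) (inj₂ j) = (toℕ j ≡ᵇ (toℕ i + r) % n) ∨ (toℕ i ≡ᵇ (toℕ j + r) % n)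
  ad (inj₁ i) (inj₂ j) = xy i j
  ad (inj₂ j) (inj₁ i) = xy i j

FinGraph : (n : ℕ) → (Fin n → Fin n → Bool) → Graph
FinGraph n a = record { V = Fin n ; adj = a }

{-# OPTIONS --safe #-}
module Submission where

open import Defs
open import Data.Bool using (Bool; true; false; _∧_; _∨_; T; if_then_else_)
open import Data.Bool.ListAction using (all; any)
open import Data.Bool.Properties using (T-∧; T-∨)
import Data.Bool.Properties as Bool
open import Data.Empty using (⊥; ⊥-elim)
open import Data.Fin using (Fin; zero; suc; toℕ; combine; remQuot; splitAt; join)
import Data.Fin.Properties as Fin
open import Data.List using (List; []; _∷_; _++_; map; concatMap; upTo; filter; allFin; length; lookup; tabulate)
import Data.List.Properties as List
open import Data.List.Membership.Propositional.Properties using (∈-lookup)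
open import Data.List.Relation.Unary.All using (All; []; _∷_)
import Data.List.Relation.Unary.All as All
import Data.List.Relation.Unary.All.Properties as All
open import Data.List.Relation.Unary.AllPairs using ([]; _∷_)
open import Data.List.Relation.Unary.Unique.Propositional using (Unique)
import Data.List.Relation.Unary.Unique.Propositional.Properties as Unique
import Data.Nat as ℕ
open import Data.Nat using (ℕ; zero; suc; _+_; _*_; _^_; _%_; _/_; _∸_; _≡ᵇ_; _<ᵇ_; _≤_; s≤s; z≤n)
open import Data.Nat.DivMod using (_mod_)
open import Data.Nat.Properties using (≡ᵇ⇒≡; <ᵇ⇒<; m+n∸m≡n; m≤m+n; m<m*n; <⇒≱; ≤-refl)
open import Data.Product using (Σ; ∃; _×_; _,_; proj₁; proj₂; swap; uncurry)
open import Data.Sum using (_⊎_; inj₁; inj₂)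
open import Data.Unit using (tt)
open import Function using (_∘_; id; flip)
open import Function.Bundles using (_⇔_; Equivalence; mk⇔)
open import Relation.Binary.Definitions using (DecidableEquality)
open import Relation.Binary.PropositionalEquality using (_≡_; _≢_; refl; sym; trans; cong; cong₂; subst; subst₂)
open import Relation.Nullary using (¬_; Dec; yes; no)
open import Relation.Nullary.Decidable using (from-yes; _×-dec_; _→-dec_)

-- Orient Γ by the orbit of an arc. A symmetry in G takes any arc to any other, so each configuration of
-- vertices found around one arc reappears around every arc; moreover every vertex has at most two
-- successors and at most two predecessors, and there are no cycles of length 3 or 4. An undirected 5-cycle
-- has one of three orientation types. Starting from such a cycle and repeatedly transferring known
-- configurations to other arcs, a finite case distinction on coincidences of vertices either reaches a
-- contradiction or closes up to all arcs of X_o(3,9;4) or R_12(5,2). The configuration then covers Γ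
-- by connectedness, injectively because both graphs have diameter 3 while Γ has girth 5.

-- A certificate checker for oriented graphs with an arc-transitive symmetry group

-- Neither the order of Γ nor the group G is bounded in advance, and no decision procedure for the
-- orbit is given, so nothing about Γ can be enumerated. The argument therefore keeps only finitely
-- many named vertices, with the arcs and inequations known between them; its only case distinction
-- is whether two vertices are equal, which is decidable. The case tree is data, and a checker
-- proved sound once turns its evaluation into a proof. Type C is contradictory, type B leads only
-- to the second orientation of R_12(5,2), and type A to its first orientation and to both
-- orientations of the Doyle-Holt graph. For the converse, one orientation of each graph is fixed
-- and G consists of all automorphisms preserving it. This group cannot reverse an arc, and finitely
-- many words in three explicit symmetries show that it is transitive on the oriented arcs.

∧-split : ∀ x {y} → T (x ∧ y) → T x × T y
∧-split x = Equivalence.to (T-∧ {x})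

∨-split : ∀ x {y} → T (x ∨ y) → T x ⊎ T y
∨-split x = Equivalence.to (T-∨ {x})

Name : Set
Name = ℕ

-- Exactly the facts that survive an injective arc-preserving map. A missing arc is never recorded.
data Atom : Set where
  _⇒_ _≠_ : Name → Name → Atom

infix 6 _⇒_ _≠_

Pattern : Set
Pattern = List Atom

rename : (Name → Name) → Atom → Atom
rename f (a ⇒ b) = f a ⇒ f b
rename f (a ≠ b) = f a ≠ f b

_==_ : Atom → Atom → Bool
(a ⇒ b) == (c ⇒ d) = (a ≡ᵇ c) ∧ (b ≡ᵇ d)
(a ≠ b) == (c ≠ d) = ((a ≡ᵇ c) ∧ (b ≡ᵇ d)) ∨ ((a ≡ᵇ d) ∧ (b ≡ᵇ c))
_       == _       = false

contains : Pattern → Atom → Bool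
contains S x = any (x ==_) S

_⊆ᵇ_ : Pattern → Pattern → Bool
P ⊆ᵇ S = all (contains S) P

below : ℕ → Atom → Bool
below k (a ⇒ b) = (a <ᵇ k) ∧ (b <ᵇ k)
below k (a ≠ b) = (a <ᵇ k) ∧ (b <ᵇ k)

_[_↦_] : Pattern → Name → Name → Pattern
S [ b ↦ a ] = map (rename (λ c → if c ≡ᵇ b then a else c)) S

-- The default is harmless: every map of names is a legitimate instantiation, because the
-- instantiated pattern is compared with the known facts.
nth : List Name → Name → Name
nth []       _       = 0
nth (x ∷ _)  zero    = x
nth (_ ∷ xs) (suc i) = nth xs i

-- An index out of range yields a pattern without arcs, which `use` rejects.
lookupRule : List Pattern → ℕ → Pattern
lookupRule []       _       = []
lookupRule (P ∷ _)  zero    = P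
lookupRule (_ ∷ Ps) (suc r) = lookupRule Ps r

transferred : ℕ → (a b c d : Name) → Name → Name
transferred k a b c d i = if i ≡ᵇ a then c else if i ≡ᵇ b then d else k + i

-- A certificate reasons about a configuration of named vertices, starting from its pattern.
-- `close` matches a pattern known to settle the goal; `split a b` first treats a = b (renaming b to a),
-- then a ≠ b; `adopt` records part of the configuration; `use r a b c d k` maps the r-th recorded part by
-- a symmetry taking the arc (a , b) to (c , d), its other names being shifted by k to make them fresh.
data Cert (Closer : Set) : Set where
  close : Closer → List Name → Cert Closer
  split : Name → Name → Cert Closer → Cert Closer → Cert Closer
  adopt : Pattern → Cert Closer → Cert Closer
  use   : ℕ → (a b c d : Name) → ℕ → Cert Closer → Cert Closer

module Check {Closer : Set} (pattern-of : Closer → Pattern) where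

  check : List Pattern → Pattern → Cert Closer → Bool
  check Rs S (close p ns)       = map (rename (nth ns)) (pattern-of p) ⊆ᵇ S
  check Rs S (split a b t u)    = check Rs (S [ b ↦ a ]) t ∧ check Rs (a ≠ b ∷ S) u
  check Rs S (adopt P t)        = (P ⊆ᵇ S) ∧ check (P ∷ Rs) S t
  check Rs S (use r a b c d k t) =
    contains (lookupRule Rs r) (a ⇒ b) ∧ (contains S (c ⇒ d) ∧ (all (below k) S ∧
      check Rs (map (rename (transferred k a b c d)) (lookupRule Rs r) ++ S) t))

-- Meaning of patterns and soundness of the checker

module Semantics {V : Set} (_≟_ : DecidableEquality V) (O : V → V → Set) where

  ⟦_⟧ : Atom → (Name → V) → Set
  ⟦ a ⇒ b ⟧ ρ = O (ρ a) (ρ b)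
  ⟦ a ≠ b ⟧ ρ = ρ a ≢ ρ b

  Models : (Name → V) → Pattern → Set
  Models ρ = All (λ x → ⟦ x ⟧ ρ)

  rename-⟦⟧ : ∀ f ρ x → ⟦ x ⟧ (ρ ∘ f) → ⟦ rename f x ⟧ ρ
  rename-⟦⟧ f ρ (a ⇒ b) h = h
  rename-⟦⟧ f ρ (a ≠ b) h = h

  rename-⟦⟧⁻ : ∀ f ρ x → ⟦ rename f x ⟧ ρ → ⟦ x ⟧ (ρ ∘ f)
  rename-⟦⟧⁻ f ρ (a ⇒ b) h = h
  rename-⟦⟧⁻ f ρ (a ≠ b) h = h

  ⟦⟧-cong : ∀ {ρ ρ′} x → (∀ i → ρ i ≡ ρ′ i) → ⟦ x ⟧ ρ → ⟦ x ⟧ ρ′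
  ⟦⟧-cong (a ⇒ b) e h = subst₂ O (e a) (e b) h
  ⟦⟧-cong (a ≠ b) e h q = h (trans (e a) (trans q (sym (e b))))

  ==-sound : ∀ x y ρ → T (x == y) → ⟦ y ⟧ ρ → ⟦ x ⟧ ρ
  ==-sound (a ⇒ b) (c ⇒ d) ρ e h with ∧-split (a ≡ᵇ c) e
  ... | p , q rewrite ≡ᵇ⇒≡ a c p | ≡ᵇ⇒≡ b d q = h
  ==-sound (a ≠ b) (c ≠ d) ρ e h with ∨-split ((a ≡ᵇ c) ∧ (b ≡ᵇ d)) e
  ... | inj₁ f with ∧-split (a ≡ᵇ c) f
  ...   | p , q rewrite ≡ᵇ⇒≡ a c p | ≡ᵇ⇒≡ b d q = h
  ==-sound (a ≠ b) (c ≠ d) ρ e h | inj₂ f with ∧-split (a ≡ᵇ d) f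
  ...   | p , q rewrite ≡ᵇ⇒≡ a d p | ≡ᵇ⇒≡ b c q = h ∘ sym

  contains-sound : ∀ {ρ} S x → T (contains S x) → Models ρ S → ⟦ x ⟧ ρ
  contains-sound (y ∷ S) x e (h ∷ hs) with ∨-split (x == y) e
  ... | inj₁ p = ==-sound x y _ p h
  ... | inj₂ p = contains-sound S x p hs

  ⊆ᵇ-sound : ∀ {ρ} P S → T (P ⊆ᵇ S) → Models ρ S → Models ρ P
  ⊆ᵇ-sound []      S e hs = []
  ⊆ᵇ-sound (x ∷ P) S e hs with ∧-split (contains S x) e
  ... | p , q = contains-sound S x p hs ∷ ⊆ᵇ-sound P S q hs

  rename-Models : ∀ f ρ P → Models (ρ ∘ f) P → Models ρ (map (rename f) P)
  rename-Models f ρ []      []       = []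
  rename-Models f ρ (x ∷ P) (h ∷ hs) = rename-⟦⟧ f ρ x h ∷ rename-Models f ρ P hs

  rename-Models⁻ : ∀ f ρ P → Models ρ (map (rename f) P) → Models (ρ ∘ f) P
  rename-Models⁻ f ρ []      []       = []
  rename-Models⁻ f ρ (x ∷ P) (h ∷ hs) = rename-⟦⟧⁻ f ρ x h ∷ rename-Models⁻ f ρ P hs

  Models-cong : ∀ {ρ ρ′} P → (∀ i → ρ i ≡ ρ′ i) → Models ρ P → Models ρ′ P
  Models-cong P e = All.map (λ {x} → ⟦⟧-cong x e)

  Embedding : V → V → V → V → Set
  Embedding x y x′ y′ = Σ (V → V) λ g → (∀ u v → g u ≡ g v → u ≡ v)
    × (∀ {u v} → O u v → O (g u) (g v)) × g x ≡ x′ × g y ≡ y′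

  Models-∘ : ∀ {ρ} P g → (∀ u v → g u ≡ g v → u ≡ v) → (∀ {u v} → O u v → O (g u) (g v)) →
             Models ρ P → Models (g ∘ ρ) P
  Models-∘ P g inj hom = All.map λ { {a ⇒ b} → hom ; {a ≠ b} n e → n (inj _ _ e) }

  -- The bound `k` divides the names into the old ones and a shifted copy of all names, so freshness
  -- needs no further bookkeeping.
  extend : ℕ → (ρ σ : Name → V) → Name → V
  extend k ρ σ i = if i <ᵇ k then ρ i else σ (i ∸ k)

  extend-old : ∀ k ρ σ i → T (i <ᵇ k) → ρ i ≡ extend k ρ σ i
  extend-old k ρ σ i e with i <ᵇ k
  ... | true = refl

  extend-new : ∀ k ρ σ i → extend k ρ σ (k + i) ≡ σ i
  extend-new k ρ σ i with (k + i) <ᵇ k in eq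
  ... | true  = ⊥-elim (<⇒≱ (<ᵇ⇒< (k + i) k (subst T (sym eq) tt)) (m≤m+n k i))
  ... | false = cong σ (m+n∸m≡n k i)

  extend-Models : ∀ k ρ σ S → T (all (below k) S) → Models ρ S → Models (extend k ρ σ) S
  extend-Models k ρ σ []            e []       = []
  extend-Models k ρ σ ((a ⇒ b) ∷ S) e (h ∷ hs) with ∧-split (below k (a ⇒ b)) e
  ... | p , q with ∧-split (a <ᵇ k) p
  ... | pa , pb = subst₂ O (extend-old k ρ σ a pa) (extend-old k ρ σ b pb) h ∷ extend-Models k ρ σ S q hs
  extend-Models k ρ σ ((a ≠ b) ∷ S) e (h ∷ hs) with ∧-split (below k (a ≠ b)) e
  ... | p , q with ∧-split (a <ᵇ k) p
  ... | pa , pb = (λ r → h (trans (extend-old k ρ σ a pa) (trans r (sym (extend-old k ρ σ b pb))))) ∷ extend-Models k ρ σ S q hs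

  module Soundness
    (homogeneous : ∀ {x y x′ y′} → O x y → O x′ y′ → Embedding x y x′ y′)
    {Closer : Set} (pattern-of : Closer → Pattern) {Goal : Set}
    (closes : ∀ p ρ → Models ρ (pattern-of p) → Goal) where

    open Check pattern-of

    -- A recorded part carries its own valuation, so it stays available when the current names are
    -- identified or extended.
    Realised : Pattern → Set
    Realised P = ∃ λ ρ → Models ρ P

    lookupRule-Realised : ∀ {Rs} r → All Realised Rs → V → Realised (lookupRule Rs r)
    lookupRule-Realised r       []       v = (λ _ → v) , []
    lookupRule-Realised zero    (h ∷ _)  v = h
    lookupRule-Realised (suc r) (_ ∷ hs) v = lookupRule-Realised r hs v

    sound : ∀ {Rs S ρ} t → T (check Rs S t) → All Realised Rs → Models ρ S → Goal
    sound {S = S} {ρ} (close p ns) e R hs =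
      closes p (ρ ∘ nth ns) (rename-Models⁻ (nth ns) ρ (pattern-of p) (⊆ᵇ-sound _ S e hs))
    sound {Rs} {S} {ρ} (split a b t u) e R hs with ∧-split (check Rs (S [ b ↦ a ]) t) e
    ... | e₁ , e₂ with ρ a ≟ ρ b
    ...   | no a≢b = sound u e₂ R (a≢b ∷ hs)
    -- The valuation does not change: as `ρ a` and `ρ b` agree, reading `a` for `b` gives the same
    -- vertices.
    ...   | yes a≡b = sound t e₁ R (rename-Models _ ρ S (Models-cong S same hs))
      where
      same : ∀ i → ρ i ≡ ρ (if i ≡ᵇ b then a else i)
      same i with i ≡ᵇ b in eq
      ... | true  = trans (cong ρ (≡ᵇ⇒≡ i b (subst T (sym eq) tt))) (sym a≡b)
      ... | false = refl
    sound {Rs} {S} {ρ} (adopt P t) e R hs with ∧-split (P ⊆ᵇ S) e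
    ... | e₁ , e₂ = sound t e₂ ((ρ , ⊆ᵇ-sound P S e₁ hs) ∷ R) hs
    sound {Rs} {S} {ρ} (use r a b c d k t) e R hs
      with ∧-split (contains (lookupRule Rs r) (a ⇒ b)) e
    ... | e₁ , e′ with ∧-split (contains S (c ⇒ d)) e′
    ... | e₂ , e″ with ∧-split (all (below k) S) e″
    -- `ρ c` is supplied as an inhabitant of `V`, for the default valuation of an index out of
    -- range.
    ... | e₃ , e₄ with lookupRule-Realised r R (ρ c)
    ... | σ , hσ with homogeneous (contains-sound (lookupRule Rs r) (a ⇒ b) e₁ hσ) (contains-sound S (c ⇒ d) e₂ hs)
    ... | g , inj , hom , gc , gd =
      sound t e₄ R (All.++⁺ (rename-Models _ ρ′ (lookupRule Rs r)
                              (Models-cong (lookupRule Rs r) same (Models-∘ (lookupRule Rs r) g inj hom hσ)))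
                            (extend-Models k ρ (g ∘ σ) S e₃ hs))
      where
      ρ′ : Name → V
      ρ′ = extend k ρ (g ∘ σ)
      -- The target arc occurs in `S`, so its ends inherit the bound on the names of `S` and keep
      -- their old values.
      bounded : ∀ S → T (contains S (c ⇒ d)) → T (all (below k) S) → T (c <ᵇ k) × T (d <ᵇ k)
      bounded ((x ⇒ y) ∷ S) p q with ∨-split ((c ⇒ d) == (x ⇒ y)) p | ∧-split (below k (x ⇒ y)) q
      ... | inj₂ p′ | _ , q′ = bounded S p′ q′
      ... | inj₁ p′ | q′ , _ with ∧-split (c ≡ᵇ x) p′
      ...   | u , v rewrite ≡ᵇ⇒≡ c x u | ≡ᵇ⇒≡ d y v = ∧-split (x <ᵇ k) q′
      bounded ((x ≠ y) ∷ S) p q = bounded S p (proj₂ (∧-split (below k (x ≠ y)) q))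
      same : ∀ i → g (σ i) ≡ ρ′ (transferred k a b c d i)
      same i with i ≡ᵇ a in eqa
      ... | true = trans (cong (g ∘ σ) (≡ᵇ⇒≡ i a (subst T (sym eqa) tt)))
                     (trans gc (extend-old k ρ (g ∘ σ) c (proj₁ (bounded S e₂ e₃))))
      ... | false with i ≡ᵇ b in eqb
      ...   | true = trans (cong (g ∘ σ) (≡ᵇ⇒≡ i b (subst T (sym eqb) tt)))
                       (trans gd (extend-old k ρ (g ∘ σ) d (proj₂ (bounded S e₂ e₃))))
      ...   | false = sym (extend-new k ρ (g ∘ σ) i)

-- Certificates

Arcs : Set
Arcs = List (Name × Name)

-- u_i^j of X_o(3,9;4) has the name 9 i + j; x_i and y_i of R_12(5,2) have the names i and 12 + i.
doyleHoltArcs : Arcs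
doyleHoltArcs = concatMap (λ i → concatMap (λ j →
    (9 * i + j , 9 * (suc i % 3) + (j + 4 ^ i) % 9) ∷
    (9 * i + j , 9 * (suc i % 3) + (j + (9 ∸ 4 ^ i % 9)) % 9) ∷ []) (upTo 9)) (upTo 3)

-- R_12(5,2) has two essentially different half-arc-transitive orientations.
roseArcs roseArcs′ : Arcs
roseArcs = concatMap (λ i →
    (i , (i + 1) % 12) ∷ (i , 12 + i) ∷ (12 + i , 12 + (i + 10) % 12) ∷ (12 + i , (i + 5) % 12) ∷ []) (upTo 12)
roseArcs′ = concatMap (λ k → let i = 2 * k ; j = 1 + 2 * k in
    (i , 12 + i) ∷ (i , 12 + (i + 7) % 12) ∷ (12 + i , 12 + (i + 2) % 12) ∷ (12 + i , (i + 5) % 12) ∷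
    (j , (j + 1) % 12) ∷ (j , (j + 11) % 12) ∷ (12 + j , 12 + (j + 10) % 12) ∷ (12 + j , j) ∷ []) (upTo 6)

-- The Doyle-Holt graph has no automorphism reversing an arc, so its orientation and the reversed
-- one are separate targets.
data Completion : Set where
  doyleHolt doyleHolt⁻ rose rose′ : Completion

arcs : Completion → Arcs
arcs doyleHolt  = doyleHoltArcs
arcs doyleHolt⁻ = map swap doyleHoltArcs
arcs rose       = roseArcs
arcs rose′      = roseArcs′

-- Two successors, or two predecessors, of one vertex are not kept apart by girth or by asymmetry of
-- the orientation, so their distinctness has to be demanded. The order test lists each pair once.
siblings : Name × Name → Name × Name → Pattern
siblings (a , b) (c , d) =
  (if (a ≡ᵇ c) ∧ (b <ᵇ d) then b ≠ d ∷ [] else []) ++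
  (if (b ≡ᵇ d) ∧ (a <ᵇ c) then a ≠ c ∷ [] else [])

orientedPattern : Arcs → Pattern
orientedPattern L =
  map (λ (a , b) → a ⇒ b) L ++ concatMap (λ e → concatMap (siblings e) L) L

-- The two orientations of a triangle and the four of a 4-cycle up to symmetry, the two violations
-- of the valency, and the finished graphs. A 4-cycle demands distinct opposite vertices only where
-- they are not the ends of a directed path of length two.
data Closer : Set where
  Cycle₃ Transitive₃ Cycle₄ Path₃₊₁ Path₂₊₂ Alternating₄ Out₃ In₃ : Closer
  Complete : Completion → Closer

patternOf : Closer → Pattern
patternOf Cycle₃       = 0 ⇒ 1 ∷ 1 ⇒ 2 ∷ 2 ⇒ 0 ∷ []
patternOf Transitive₃  = 0 ⇒ 1 ∷ 1 ⇒ 2 ∷ 0 ⇒ 2 ∷ []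
patternOf Cycle₄       = 0 ⇒ 1 ∷ 1 ⇒ 2 ∷ 2 ⇒ 3 ∷ 3 ⇒ 0 ∷ []
patternOf Path₃₊₁      = 0 ⇒ 1 ∷ 1 ⇒ 2 ∷ 2 ⇒ 3 ∷ 0 ⇒ 3 ∷ []
patternOf Path₂₊₂      = 0 ⇒ 1 ∷ 1 ⇒ 2 ∷ 0 ⇒ 3 ∷ 3 ⇒ 2 ∷ 1 ≠ 3 ∷ []
patternOf Alternating₄ = 0 ⇒ 1 ∷ 2 ⇒ 1 ∷ 2 ⇒ 3 ∷ 0 ⇒ 3 ∷ 0 ≠ 2 ∷ 1 ≠ 3 ∷ []
patternOf Out₃         = 0 ⇒ 1 ∷ 0 ⇒ 2 ∷ 0 ⇒ 3 ∷ 1 ≠ 2 ∷ 1 ≠ 3 ∷ 2 ≠ 3 ∷ []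
patternOf In₃          = 1 ⇒ 0 ∷ 2 ⇒ 0 ∷ 3 ⇒ 0 ∷ 1 ≠ 2 ∷ 1 ≠ 3 ∷ 2 ≠ 3 ∷ []
patternOf (Complete o) = orientedPattern (arcs o)

open Check patternOf

Certificate : Set
Certificate = Cert Closer

-- The case a ≠ b is refuted by the first certificate.
merge : Name → Name → Certificate → Certificate → Certificate
merge a b t u = split a b u t

cycle₃ transitive₃ : (a b c : Name) → Certificate
cycle₃ a b c      = close Cycle₃ (a ∷ b ∷ c ∷ [])
transitive₃ a b c = close Transitive₃ (a ∷ b ∷ c ∷ [])

cycle₄ path₃₊₁ path₂₊₂ alternating₄ out₃ in₃ : (a b c d : Name) → Certificate
cycle₄ a b c d       = close Cycle₄ (a ∷ b ∷ c ∷ d ∷ [])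
path₃₊₁ a b c d      = close Path₃₊₁ (a ∷ b ∷ c ∷ d ∷ [])
path₂₊₂ a b c d      = close Path₂₊₂ (a ∷ b ∷ c ∷ d ∷ [])
alternating₄ a b c d = close Alternating₄ (a ∷ b ∷ c ∷ d ∷ [])
out₃ a b c d         = close Out₃ (a ∷ b ∷ c ∷ d ∷ [])
in₃ a b c d          = close In₃ (a ∷ b ∷ c ∷ d ∷ [])

complete : Completion → List Name → Certificate
complete o = close (Complete o)

-- Up to symmetry and reversal, the three ways of orienting a 5-cycle that are not cyclic.
patternA patternB patternC : Pattern
patternA = 0 ⇒ 1 ∷ 1 ⇒ 2 ∷ 2 ⇒ 3 ∷ 3 ⇒ 4 ∷ 0 ⇒ 4 ∷ []
patternB = 0 ⇒ 1 ∷ 1 ⇒ 2 ∷ 2 ⇒ 3 ∷ 4 ⇒ 3 ∷ 0 ⇒ 4 ∷ []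
patternC = 0 ⇒ 1 ∷ 1 ⇒ 2 ∷ 3 ⇒ 2 ∷ 3 ⇒ 4 ∷ 0 ⇒ 4 ∷ []

-- Found by computer search. In type A all five type-A cycles through the arc (0 , 1) are drawn first; each
-- resulting local configuration (certA₀ to certA₁₁) is then transferred to further arcs.

certA₀ : Certificate
certA₀ =
  adopt (0 ⇒ 1 ∷ 1 ⇒ 2 ∷ 2 ⇒ 9 ∷ 5 ⇒ 0 ∷ 5 ⇒ 9 ∷ 12 ⇒ 1 ∷ 12 ⇒ 13 ∷ 13 ⇒ 5 ∷ 0 ≠ 9 ∷ 0 ≠ 12 ∷ 1 ≠ 13 ∷
      2 ≠ 5 ∷ []) (
  use 0 0 1 3 4 17 (merge 0 29 (in₃ 4 0 3 29) (merge 1 30 (out₃ 0 1 4 30) (merge 2 22 (path₂₊₂ 1 2 3 22) (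
  merge 9 26 (out₃ 2 3 9 26) (split 5 19 (cycle₃ 0 4 5) (in₃ 9 2 5 19)))))))

certA₁ : Certificate
certA₁ =
  adopt (0 ⇒ 1 ∷ 0 ⇒ 4 ∷ 1 ⇒ 2 ∷ 2 ⇒ 3 ∷ 2 ⇒ 9 ∷ 3 ⇒ 4 ∷ 5 ⇒ 0 ∷ 5 ⇒ 9 ∷ 0 ≠ 3 ∷ 1 ≠ 4 ∷ 2 ≠ 5 ∷ 3 ≠ 9 ∷ []) (
  use 0 0 1 10 11 17 (merge 2 21 (out₃ 10 2 11 21) (merge 1 20 (in₃ 2 1 10 20) (
  merge 0 19 (path₂₊₂ 11 0 1 19) (merge 4 26 (out₃ 0 1 4 26) (split 3 22 (cycle₃ 2 3 10) (in₃ 4 0 3 22)))))))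

certA₂ : Certificate
certA₂ =
  adopt (0 ⇒ 1 ∷ 1 ⇒ 2 ∷ 2 ⇒ 9 ∷ 5 ⇒ 0 ∷ 5 ⇒ 9 ∷ 15 ⇒ 1 ∷ 15 ⇒ 16 ∷ 16 ⇒ 5 ∷ 0 ≠ 9 ∷ 0 ≠ 15 ∷ 1 ≠ 16 ∷
      2 ≠ 5 ∷ []) (
  use 0 0 1 3 4 20 (merge 0 35 (in₃ 4 0 3 35) (merge 1 36 (out₃ 0 1 4 36) (merge 2 25 (path₂₊₂ 1 2 3 25) (
  merge 9 29 (out₃ 2 3 9 29) (split 5 22 (cycle₃ 0 4 5) (in₃ 9 2 5 22)))))))

certA₃ : Certificate
certA₃ =
  adopt (0 ⇒ 1 ∷ 0 ⇒ 4 ∷ 1 ⇒ 2 ∷ 1 ⇒ 14 ∷ 2 ⇒ 3 ∷ 2 ⇒ 9 ∷ 3 ⇒ 4 ∷ 4 ⇒ 20 ∷ 5 ⇒ 0 ∷ 5 ⇒ 9 ∷ 10 ⇒ 5 ∷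
      10 ⇒ 14 ∷ 15 ⇒ 1 ∷ 15 ⇒ 16 ∷ 16 ⇒ 17 ∷ 17 ⇒ 0 ∷ 20 ⇒ 15 ∷ 0 ≠ 3 ∷ 0 ≠ 9 ∷ 0 ≠ 15 ∷ 1 ≠ 4 ∷ 1 ≠ 10 ∷
      1 ≠ 16 ∷ 2 ≠ 5 ∷ 2 ≠ 14 ∷ 3 ≠ 9 ∷ 5 ≠ 14 ∷ 5 ≠ 17 ∷ []) (
  use 0 0 1 2 3 21 (merge 9 25 (out₃ 2 3 9 25) (merge 5 24 (in₃ 9 2 5 24) (split 4 23 (cycle₃ 0 4 5) (
  merge 4 35 (out₃ 3 4 23 35) (merge 0 31 (in₃ 4 0 3 31) (merge 1 26 (path₂₊₂ 0 1 2 26) (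
  merge 14 30 (out₃ 1 2 14 30) (merge 10 23 (alternating₄ 10 5 23 14) (use 0 0 1 10 5 42 (
  merge 14 46 (out₃ 10 5 14 46) (merge 1 45 (in₃ 14 1 10 45) (merge 0 44 (path₂₊₂ 5 0 1 44) (
  merge 4 51 (out₃ 0 1 4 51) (merge 3 47 (alternating₄ 3 4 47 10) (merge 9 56 (out₃ 5 0 9 56) (
  merge 2 52 (alternating₄ 52 3 2 9) (use 0 0 1 0 4 63 (merge 1 67 (out₃ 0 1 4 67) (
  merge 3 78 (in₃ 4 0 3 78) (merge 2 83 (path₂₊₂ 1 2 3 83) (merge 10 79 (out₃ 3 4 10 79) (
  split 5 68 (path₂₊₂ 10 5 0 80) (merge 5 80 (in₃ 0 5 68 80) (merge 15 66 (in₃ 1 0 15 66) (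
  merge 17 68 (in₃ 0 5 17 68) (merge 20 65 (path₂₊₂ 4 20 15 65) (split 16 73 (
   use 0 0 1 4 77 78 (merge 16 93 (in₃ 77 4 16 93) (merge 17 94 (out₃ 16 17 77 94) (
   split 0 83 (path₂₊₂ 17 0 4 95) (merge 0 95 (in₃ 4 0 83 95) (merge 3 83 (in₃ 4 0 3 83) (
   merge 10 87 (out₃ 3 4 10 87) (merge 20 82 (out₃ 4 20 77 82) (merge 15 98 (path₂₊₂ 20 15 16 98) (
   merge 59 80 (in₃ 10 3 59 80) (split 2 88 (
    merge 9 92 (out₃ 2 3 9 92) (split 5 77 (cycle₃ 59 10 5) (in₃ 9 2 5 77))) (merge 36 88 (in₃ 3 2 36 88) (
    merge 37 92 (out₃ 36 3 37 92) (split 58 77 (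
     split 4 57 (path₂₊₂ 3 4 5 10) (split 16 57 (path₂₊₂ 16 5 0 17) (in₃ 58 4 16 57))) (use 0 0 1 1 14 82 (
     merge 2 86 (out₃ 1 2 14 86) (merge 10 97 (in₃ 14 1 10 97) (merge 3 102 (path₂₊₂ 2 3 10 102) (
     merge 5 98 (out₃ 10 5 14 98) (split 0 87 (path₂₊₂ 5 0 1 99) (merge 0 99 (in₃ 1 0 87 99) (
     merge 15 87 (in₃ 1 0 15 87) (merge 16 91 (out₃ 15 1 16 91) (merge 38 85 (in₃ 2 1 38 85) (
     split 37 84 (cycle₃ 37 16 77) (split 62 84 (
      split 16 57 (path₂₊₂ 16 5 0 17) (split 38 57 (path₂₊₂ 38 2 9 5) (out₃ 62 16 38 57))) (
      merge 62 96 (out₃ 14 62 84 96) (split 20 92 (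
       merge 62 72 (out₃ 20 15 62 72) (split 14 17 (cycle₃ 14 0 1) (in₃ 62 14 17 20))) (use 0 0 1 1 2 93 (
       merge 14 97 (out₃ 1 2 14 97) (merge 10 96 (in₃ 14 1 10 96) (merge 3 95 (path₂₊₂ 2 3 10 95) (
       merge 4 102 (out₃ 3 4 10 102) (merge 0 98 (in₃ 4 0 3 98) (merge 9 107 (out₃ 2 3 9 107) (
       merge 5 103 (alternating₄ 5 0 103 9) (merge 15 110 (in₃ 1 0 15 110) (merge 38 108 (in₃ 2 1 38 108) (
       merge 84 113 (path₂₊₂ 14 84 38 113) (split 20 109 (
        split 4 38 (cycle₃ 3 4 2) (split 38 81 (path₂₊₂ 77 37 38 59) (in₃ 20 4 38 81))) (
        merge 92 109 (in₃ 15 20 92 109) (use 0 0 1 2 9 93 (merge 3 97 (out₃ 2 3 9 97) (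
        merge 5 108 (in₃ 9 2 5 108) (merge 0 109 (out₃ 5 0 9 109) (split 1 98 (path₂₊₂ 0 1 2 110) (
        merge 1 110 (in₃ 2 1 98 110) (merge 10 113 (path₂₊₂ 3 10 5 113) (merge 36 96 (in₃ 3 2 36 96) (
        merge 38 98 (in₃ 2 1 38 98) (merge 41 95 (path₂₊₂ 9 41 36 95) (merge 92 102 (out₃ 38 2 92 102) (
        split 37 103 (
         use 0 0 1 3 4 108 (merge 0 123 (in₃ 4 0 3 123) (merge 1 124 (out₃ 0 1 4 124) (
         split 2 113 (path₂₊₂ 1 2 3 125) (merge 2 125 (in₃ 3 2 113 125) (merge 10 112 (out₃ 3 4 10 112) (
         merge 5 128 (path₂₊₂ 10 5 0 128) (merge 36 113 (in₃ 3 2 36 113) (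
         split 77 122 (path₂₊₂ 118 36 37 77) (merge 20 122 (out₃ 4 20 77 122) (
         merge 37 117 (out₃ 36 3 37 117) (merge 59 111 (in₃ 10 3 59 111) (
         split 58 110 (alternating₄ 58 37 77 59) (merge 77 110 (in₃ 59 58 77 110) (
         merge 81 118 (in₃ 20 4 81 118) (split 41 81 (path₂₊₂ 41 20 15 92) (use 0 0 1 5 0 108 (
         merge 9 112 (out₃ 5 0 9 112) (merge 2 111 (in₃ 9 2 5 111) (merge 1 110 (path₂₊₂ 0 1 2 110) (
         merge 4 122 (out₃ 0 1 4 122) (merge 3 118 (in₃ 4 0 3 118) (merge 10 113 (path₂₊₂ 3 10 5 113) (
         merge 14 117 (alternating₄ 10 14 1 117) (merge 17 123 (in₃ 0 5 17 123) (
         merge 57 125 (in₃ 5 10 57 125) (merge 72 124 (out₃ 17 0 72 124) (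
         split 62 72 (alternating₄ 92 15 20 62) (split 41 128 (
          split 17 36 (path₂₊₂ 17 0 4 3) (split 17 92 (alternating₄ 20 15 17 72) (out₃ 41 17 36 92))) (
          merge 107 128 (out₃ 9 41 107 128) (split 16 107 (alternating₄ 84 16 37 38) (use 0 0 1 5 9 108 (
          merge 0 112 (out₃ 5 0 9 112) (merge 2 123 (in₃ 9 2 5 123) (merge 1 128 (path₂₊₂ 0 1 2 128) (
          merge 3 124 (out₃ 2 3 9 124) (split 10 113 (path₂₊₂ 3 10 5 125) (merge 10 125 (path₂₊₂ 3 10 5 125) (
          merge 17 111 (in₃ 0 5 17 111) (split 41 110 (path₂₊₂ 9 41 17 107) (
          merge 41 122 (out₃ 9 41 110 122) (split 16 110 (path₂₊₂ 9 16 17 107) (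
          merge 57 113 (in₃ 5 10 57 113) (merge 58 117 (out₃ 57 5 58 117) (split 62 118 (cycle₃ 62 41 92) (
          merge 72 118 (in₃ 57 62 72 118) (merge 107 110 (in₃ 17 16 107 110) (use 0 0 1 10 14 108 (
          merge 1 123 (in₃ 14 1 10 123) (merge 2 124 (out₃ 1 2 14 124) (split 3 113 (path₂₊₂ 2 3 10 125) (
          merge 3 125 (in₃ 10 3 113 125) (merge 5 112 (out₃ 10 5 14 112) (merge 0 128 (path₂₊₂ 5 0 1 128) (
          merge 57 111 (in₃ 5 10 57 111) (merge 62 110 (path₂₊₂ 14 62 57 110) (
          merge 59 113 (in₃ 10 3 59 113) (merge 81 117 (out₃ 59 10 81 117) (merge 84 122 (out₃ 14 62 84 122) (
          split 77 118 (path₂₊₂ 77 37 38 84) (merge 58 118 (in₃ 59 58 77 118) (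
          complete doyleHolt⁻ (1 ∷ 41 ∷ 4 ∷ 107 ∷ 10 ∷ 38 ∷ 81 ∷ 16 ∷ 57 ∷ 72 ∷ 0 ∷ 9 ∷ 3 ∷ 37 ∷ 59 ∷ 84 ∷
      62 ∷ 15 ∷ 77 ∷ 58 ∷ 14 ∷ 92 ∷ 20 ∷ 17 ∷ 5 ∷ 2 ∷ 36 ∷
      [])))))))))))))))))))))))))))))))))))))))))))))))))))))))))))))))
         (merge 84 103 (in₃ 38 37 84 103) (merge 16 107 (out₃ 84 16 38 107) (split 9 15 (cycle₃ 92 9 41) (
         in₃ 16 9 15 84)))))))))))))))))))))))))))))))))))))))))))))))))))))))))
   (use 0 0 1 4 20 78 (merge 77 82 (out₃ 4 20 77 82) (merge 73 81 (in₃ 77 4 73 81) (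
   split 15 80 (path₂₊₂ 15 16 17 73) (merge 15 92 (out₃ 20 15 80 92) (split 0 83 (path₂₊₂ 88 0 1 15) (
   merge 0 95 (in₃ 4 0 83 95) (merge 3 83 (in₃ 4 0 3 83) (split 2 88 (cycle₃ 1 2 15) (
   merge 10 87 (out₃ 3 4 10 87) (split 17 94 (path₂₊₂ 93 17 72 20) (merge 5 94 (in₃ 0 5 17 94) (
   merge 36 88 (in₃ 3 2 36 88) (split 15 37 (path₂₊₂ 15 1 2 38) (
   out₃ 36 3 15 37)))))))))))))))))))))))))))))))))))))))))))

certA₄ : Certificate
certA₄ =
  adopt (0 ⇒ 1 ∷ 1 ⇒ 2 ∷ 2 ⇒ 9 ∷ 5 ⇒ 0 ∷ 5 ⇒ 9 ∷ 15 ⇒ 1 ∷ 15 ⇒ 16 ∷ 16 ⇒ 5 ∷ 0 ≠ 9 ∷ 0 ≠ 15 ∷ 1 ≠ 16 ∷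
      2 ≠ 5 ∷ []) (
  use 0 0 1 3 4 20 (merge 0 35 (in₃ 4 0 3 35) (merge 1 36 (out₃ 0 1 4 36) (merge 2 25 (path₂₊₂ 1 2 3 25) (
  merge 9 29 (out₃ 2 3 9 29) (split 5 22 (cycle₃ 0 4 5) (in₃ 9 2 5 22)))))))

certA₅ : Certificate
certA₅ =
  adopt (0 ⇒ 1 ∷ 0 ⇒ 4 ∷ 1 ⇒ 14 ∷ 5 ⇒ 0 ∷ 10 ⇒ 11 ∷ 10 ⇒ 14 ∷ 11 ⇒ 0 ∷ 15 ⇒ 1 ∷ 15 ⇒ 16 ∷ 16 ⇒ 11 ∷ 0 ≠ 15 ∷
      1 ≠ 4 ∷ 1 ≠ 16 ∷ 5 ≠ 11 ∷ 10 ≠ 16 ∷ 11 ≠ 14 ∷ []) (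
  use 0 0 1 1 14 20 (merge 2 24 (out₃ 1 2 14 24) (merge 10 35 (in₃ 14 1 10 35) (
  merge 11 36 (out₃ 10 11 14 36) (split 0 25 (path₂₊₂ 11 0 1 31) (merge 0 31 (in₃ 1 0 25 31) (
  merge 5 30 (in₃ 0 5 11 30) (split 9 34 (path₂₊₂ 1 2 9 14) (out₃ 5 0 9 34)))))))))

certA₆ : Certificate
certA₆ =
  adopt (0 ⇒ 1 ∷ 1 ⇒ 2 ∷ 5 ⇒ 0 ∷ 10 ⇒ 2 ∷ 10 ⇒ 5 ∷ 11 ⇒ 1 ∷ 11 ⇒ 12 ∷ 12 ⇒ 5 ∷ 0 ≠ 11 ∷ 1 ≠ 12 ∷ 2 ≠ 5 ∷
      10 ≠ 12 ∷ []) (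
  use 0 0 1 3 4 16 (merge 0 27 (in₃ 4 0 3 27) (merge 1 28 (out₃ 0 1 4 28) (merge 2 21 (path₂₊₂ 1 2 3 21) (
  merge 10 26 (in₃ 2 1 10 26) (split 5 18 (cycle₃ 0 4 5) (out₃ 10 2 5 18)))))))

certA₇ : Certificate
certA₇ =
  adopt (0 ⇒ 1 ∷ 0 ⇒ 4 ∷ 1 ⇒ 2 ∷ 1 ⇒ 8 ∷ 2 ⇒ 3 ∷ 3 ⇒ 4 ∷ 5 ⇒ 0 ∷ 10 ⇒ 2 ∷ 10 ⇒ 5 ∷ 13 ⇒ 0 ∷ 0 ≠ 3 ∷ 1 ≠ 4 ∷
      1 ≠ 10 ∷ 2 ≠ 5 ∷ 2 ≠ 8 ∷ 5 ≠ 13 ∷ []) (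
  use 0 0 1 5 0 17 (merge 9 21 (out₃ 5 0 9 21) (merge 8 20 (in₃ 9 5 8 20) (merge 1 19 (path₂₊₂ 0 1 8 19) (
  merge 4 25 (out₃ 0 1 4 25) (split 10 22 (path₂₊₂ 27 1 2 10) (merge 10 30 (in₃ 5 10 22 30) (
  merge 11 27 (in₃ 1 0 11 27) (split 12 22 (path₂₊₂ 12 5 0 13) (out₃ 11 1 12 22))))))))))

certA₈ : Certificate
certA₈ =
  adopt (0 ⇒ 1 ∷ 0 ⇒ 4 ∷ 1 ⇒ 2 ∷ 1 ⇒ 8 ∷ 2 ⇒ 3 ∷ 3 ⇒ 4 ∷ 4 ⇒ 16 ∷ 5 ⇒ 0 ∷ 5 ⇒ 9 ∷ 8 ⇒ 9 ∷ 10 ⇒ 2 ∷ 10 ⇒ 11 ∷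
      11 ⇒ 0 ∷ 12 ⇒ 1 ∷ 12 ⇒ 13 ∷ 13 ⇒ 5 ∷ 16 ⇒ 12 ∷ 0 ≠ 3 ∷ 0 ≠ 9 ∷ 0 ≠ 12 ∷ 1 ≠ 4 ∷ 1 ≠ 10 ∷ 1 ≠ 13 ∷
      2 ≠ 8 ∷ 2 ≠ 11 ∷ 5 ≠ 8 ∷ 5 ≠ 11 ∷ []) (
  use 0 0 1 0 4 17 (merge 1 21 (out₃ 0 1 4 21) (merge 3 29 (in₃ 4 0 3 29) (merge 2 33 (path₂₊₂ 1 2 3 33) (
  merge 12 20 (in₃ 1 0 12 20) (merge 16 19 (path₂₊₂ 4 16 12 19) (split 5 22 (
   merge 9 26 (out₃ 5 0 9 26) (split 8 25 (path₂₊₂ 0 1 8 4) (in₃ 9 5 8 25))) (merge 5 28 (in₃ 0 5 22 28) (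
   merge 11 22 (in₃ 0 5 11 22) (split 10 30 (cycle₃ 2 3 10) (split 13 27 (cycle₃ 12 13 16) (
   use 0 0 1 3 4 31 (merge 0 43 (in₃ 4 0 3 43) (merge 1 44 (out₃ 0 1 4 44) (merge 2 36 (path₂₊₂ 1 2 3 36) (
   merge 30 35 (out₃ 3 4 30 35) (split 5 47 (path₂₊₂ 30 5 0 11) (merge 11 47 (in₃ 0 5 11 47) (split 16 33 (
    merge 25 39 (out₃ 4 16 25 39) (merge 27 41 (in₃ 16 4 27 41) (split 5 42 (path₂₊₂ 5 0 4 3) (
    out₃ 27 5 16 42)))) (merge 16 39 (out₃ 4 16 33 39) (merge 25 33 (out₃ 4 16 25 33) (
    split 12 40 (cycle₃ 1 2 12) (split 26 34 (cycle₃ 30 11 26) (use 0 0 1 1 8 43 (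
    merge 2 47 (out₃ 1 2 8 47) (merge 10 46 (in₃ 2 1 10 46) (split 0 48 (
     merge 4 52 (out₃ 0 1 4 52) (split 3 51 (path₂₊₂ 1 2 3 8) (in₃ 4 0 3 51))) (merge 0 54 (in₃ 1 0 48 54) (
     split 11 53 (cycle₃ 11 45 10) (merge 5 53 (in₃ 0 5 11 53) (merge 9 45 (alternating₄ 8 9 5 45) (
     merge 12 48 (in₃ 1 0 12 48) (merge 13 52 (out₃ 12 1 13 52) (split 3 59 (
      split 4 55 (path₂₊₂ 0 1 8 4) (merge 30 55 (out₃ 3 4 30 55) (split 8 11 (cycle₃ 1 8 0) (
      split 11 56 (path₂₊₂ 11 0 1 12) (out₃ 30 8 11 56))))) (merge 40 59 (out₃ 2 3 40 59) (
      split 16 56 (cycle₃ 55 16 40) (use 0 0 1 3 30 57 (merge 4 61 (out₃ 3 4 30 61) (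
      merge 0 60 (in₃ 4 0 3 60) (split 5 59 (path₂₊₂ 30 5 0 11) (merge 11 59 (in₃ 0 5 11 59) (
      merge 10 67 (in₃ 11 10 30 67) (split 2 62 (path₂₊₂ 10 2 3 68) (merge 2 68 (in₃ 3 2 62 68) (
      merge 34 69 (in₃ 30 3 34 69) (merge 25 73 (path₂₊₂ 4 25 34 73) (merge 42 62 (in₃ 3 2 42 62) (
      use 0 0 1 4 16 71 (merge 25 75 (out₃ 4 16 25 75) (merge 27 83 (in₃ 16 4 27 83) (
      merge 5 84 (out₃ 27 5 16 84) (merge 0 76 (path₂₊₂ 5 0 4 76) (merge 1 80 (out₃ 0 1 4 80) (
      split 12 73 (in₃ 1 0 12 79) (merge 12 79 (in₃ 1 0 12 79) (merge 3 82 (in₃ 4 0 3 82) (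
      merge 40 73 (out₃ 16 12 40 73) (merge 2 81 (in₃ 40 2 16 81) (merge 41 74 (in₃ 25 4 41 74) (
      split 26 87 (
       split 41 55 (
        split 8 25 (in₃ 8 1 4 41) (split 8 42 (path₂₊₂ 1 2 3 8) (out₃ 41 8 25 42))) (use 0 0 1 5 9 71 (
        merge 0 75 (out₃ 5 0 9 75) (merge 8 83 (in₃ 9 5 8 83) (merge 1 87 (path₂₊₂ 0 1 8 87) (
        merge 11 74 (in₃ 0 5 11 74) (merge 10 73 (path₂₊₂ 9 10 11 73) (merge 51 84 (out₃ 8 9 51 84) (
        merge 13 76 (path₂₊₂ 51 13 5 76) (merge 27 82 (in₃ 5 13 27 82) (split 26 81 (cycle₃ 26 10 11) (
        use 0 0 1 2 3 82 (merge 40 86 (out₃ 2 3 40 86) (merge 16 85 (in₃ 40 2 16 85) (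
        merge 4 84 (path₂₊₂ 3 4 16 84) (merge 0 92 (in₃ 4 0 3 92) (split 1 87 (path₂₊₂ 0 1 2 93) (
        merge 1 93 (path₂₊₂ 0 1 2 93) (merge 10 87 (in₃ 2 1 10 87) (merge 11 91 (out₃ 10 2 11 91) (
        merge 30 90 (path₂₊₂ 3 30 11 90) (merge 42 94 (in₃ 3 2 42 94) (merge 41 98 (path₂₊₂ 40 41 42 98) (
        merge 66 95 (out₃ 42 3 66 95) (split 9 66 (
         split 5 42 (path₂₊₂ 5 0 4 3) (split 5 65 (path₂₊₂ 30 5 0 11) (in₃ 9 5 42 65))) (
         merge 66 81 (in₃ 10 9 66 81) (use 0 0 1 8 51 81 (merge 9 85 (out₃ 8 9 51 85) (
         merge 5 84 (in₃ 9 5 8 84) (merge 13 83 (path₂₊₂ 51 13 5 83) (merge 12 91 (in₃ 13 12 51 91) (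
         split 1 86 (path₂₊₂ 12 1 8 92) (merge 1 92 (path₂₊₂ 12 1 8 92) (merge 55 86 (in₃ 8 1 55 86) (
         merge 56 90 (out₃ 55 8 56 90) (split 10 97 (
          split 2 93 (path₂₊₂ 1 2 51 8) (merge 11 93 (out₃ 10 2 11 93) (split 0 51 (alternating₄ 12 1 0 13) (
          split 0 94 (path₂₊₂ 0 1 8 55) (out₃ 11 0 51 94))))) (merge 79 97 (out₃ 9 10 79 97) (
          split 80 93 (cycle₃ 13 80 51) (split 40 94 (
           split 2 93 (path₂₊₂ 1 2 51 8) (split 16 93 (path₂₊₂ 16 12 13 51) (in₃ 40 2 16 93))) (
           use 0 0 1 2 40 95 (merge 3 99 (out₃ 2 3 40 99) (merge 16 107 (in₃ 40 2 16 107) (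
           merge 4 111 (path₂₊₂ 3 4 16 111) (merge 12 108 (out₃ 16 12 40 108) (
           merge 1 100 (path₂₊₂ 12 1 2 100) (merge 8 104 (out₃ 1 2 8 104) (split 41 103 (in₃ 8 1 41 55) (
           merge 41 97 (out₃ 40 41 97 103) (merge 10 106 (in₃ 2 1 10 106) (merge 42 98 (path₂₊₂ 41 42 3 98) (
           merge 55 103 (in₃ 8 1 55 103) (split 66 105 (cycle₃ 42 66 41) (merge 9 105 (in₃ 10 9 66 105) (
           merge 41 79 (out₃ 9 10 41 79) (split 25 80 (
            split 4 13 (cycle₃ 12 4 16) (in₃ 25 4 13 41)) (merge 25 93 (out₃ 41 25 80 93) (
            split 26 51 (path₂₊₂ 26 13 5 27) (merge 26 94 (out₃ 25 26 51 94) (merge 34 51 (out₃ 25 26 34 51) (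
            split 13 30 (path₂₊₂ 13 5 0 11) (merge 13 70 (out₃ 34 13 30 70) (split 5 42 (cycle₃ 27 5 66) (
            merge 30 89 (out₃ 34 13 30 89) (split 11 56 (cycle₃ 55 11 26) (
            merge 42 80 (alternating₄ 13 42 41 80) (merge 56 65 (out₃ 30 11 56 65) (
            split 12 66 (path₂₊₂ 12 1 2 10) (split 27 55 (path₂₊₂ 27 5 9 8) (
            complete rose (0 ∷ 1 ∷ 2 ∷ 40 ∷ 41 ∷ 25 ∷ 34 ∷ 30 ∷ 56 ∷ 66 ∷ 27 ∷ 5 ∷ 4 ∷ 8 ∷ 3 ∷ 55 ∷ 42 ∷
      26 ∷ 13 ∷ 11 ∷ 12 ∷ 10 ∷ 16 ∷ 9 ∷ []))))))))))))))))))))))))))))))))))))))))))))))))))))))))))))))))))))))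
       (merge 34 87 (out₃ 25 26 34 87) (split 27 30 (path₂₊₂ 3 4 16 27) (merge 27 70 (out₃ 34 27 30 70) (
       split 5 42 (path₂₊₂ 5 0 4 3) (split 16 42 (cycle₃ 3 4 16) (
       out₃ 27 5 16 42))))))))))))))))))))))))))))))))))))))))))))))))))))))))))))))))))

certA₉ : Certificate
certA₉ =
  adopt (0 ⇒ 1 ∷ 1 ⇒ 2 ∷ 10 ⇒ 2 ∷ 10 ⇒ 11 ∷ 11 ⇒ 0 ∷ 12 ⇒ 1 ∷ 12 ⇒ 13 ∷ 13 ⇒ 11 ∷ 0 ≠ 12 ∷ 1 ≠ 13 ∷ 2 ≠ 11 ∷
      10 ≠ 13 ∷ []) (
  use 0 0 1 3 4 17 (merge 0 29 (in₃ 4 0 3 29) (merge 1 30 (out₃ 0 1 4 30) (merge 2 28 (path₂₊₂ 1 2 3 28) (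
  merge 10 27 (in₃ 2 1 10 27) (split 11 19 (cycle₃ 0 4 11) (out₃ 10 2 11 19)))))))

certA₁₀ : Certificate
certA₁₀ =
  adopt (0 ⇒ 1 ∷ 0 ⇒ 4 ∷ 1 ⇒ 8 ∷ 5 ⇒ 0 ∷ 5 ⇒ 9 ∷ 8 ⇒ 9 ∷ 12 ⇒ 1 ∷ 12 ⇒ 13 ∷ 13 ⇒ 5 ∷ 0 ≠ 9 ∷ 0 ≠ 12 ∷
      1 ≠ 4 ∷ 1 ≠ 13 ∷ 5 ≠ 8 ∷ []) (
  use 0 0 1 1 8 17 (merge 2 21 (out₃ 1 2 8 21) (merge 10 29 (in₃ 8 1 10 29) (merge 11 30 (out₃ 10 8 11 30) (
  merge 0 22 (path₂₊₂ 11 0 1 22) (merge 4 26 (out₃ 0 1 4 26) (split 3 25 (path₂₊₂ 1 2 3 8) (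
  in₃ 4 0 3 25))))))))

certA₁₁ : Certificate
certA₁₁ =
  adopt (0 ⇒ 1 ∷ 0 ⇒ 4 ∷ 1 ⇒ 2 ∷ 1 ⇒ 8 ∷ 2 ⇒ 3 ∷ 3 ⇒ 4 ∷ 4 ⇒ 16 ∷ 5 ⇒ 0 ∷ 5 ⇒ 9 ∷ 8 ⇒ 9 ∷ 10 ⇒ 8 ∷ 10 ⇒ 11 ∷
      11 ⇒ 0 ∷ 12 ⇒ 1 ∷ 12 ⇒ 13 ∷ 13 ⇒ 11 ∷ 16 ⇒ 12 ∷ 0 ≠ 3 ∷ 0 ≠ 9 ∷ 0 ≠ 12 ∷ 1 ≠ 4 ∷ 1 ≠ 10 ∷ 1 ≠ 13 ∷
      2 ≠ 8 ∷ 5 ≠ 8 ∷ 5 ≠ 11 ∷ 8 ≠ 11 ∷ 10 ≠ 13 ∷ []) (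
  use 0 0 1 5 9 17 (merge 0 21 (out₃ 5 0 9 21) (merge 8 29 (in₃ 9 5 8 29) (merge 1 33 (path₂₊₂ 0 1 8 33) (
  merge 11 20 (in₃ 0 5 11 20) (split 10 19 (cycle₃ 9 10 8) (merge 13 19 (in₃ 11 10 13 19) (
  split 9 12 (cycle₃ 1 8 9) (use 0 0 1 0 4 31 (merge 1 35 (out₃ 0 1 4 35) (merge 3 43 (in₃ 4 0 3 43) (
  merge 2 47 (path₂₊₂ 1 2 3 47) (merge 12 34 (in₃ 1 0 12 34) (merge 16 33 (path₂₊₂ 4 16 12 33) (split 5 36 (
   merge 9 40 (out₃ 5 0 9 40) (split 8 39 (path₂₊₂ 0 1 8 4) (in₃ 9 5 8 39))) (merge 5 42 (in₃ 0 5 36 42) (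
   merge 11 36 (in₃ 0 5 11 36) (split 22 41 (
    merge 26 39 (out₃ 22 5 26 39) (split 4 25 (path₂₊₂ 5 0 4 9) (in₃ 26 4 22 25))) (
    merge 22 44 (in₃ 5 22 41 44) (merge 28 41 (in₃ 5 22 28 41) (use 0 0 1 5 0 41 (
    merge 9 45 (out₃ 5 0 9 45) (merge 8 44 (in₃ 9 5 8 44) (merge 1 43 (path₂₊₂ 0 1 8 43) (
    merge 4 49 (out₃ 0 1 4 49) (split 22 46 (path₂₊₂ 3 4 50 22) (merge 22 52 (in₃ 5 22 46 52) (
    merge 3 51 (alternating₄ 3 4 51 22) (merge 11 53 (in₃ 0 5 11 53) (merge 13 57 (path₂₊₂ 9 13 11 57) (
    merge 28 46 (in₃ 5 22 28 46) (merge 39 50 (alternating₄ 4 39 28 50) (merge 40 54 (out₃ 11 0 40 54) (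
    use 0 0 1 3 22 41 (merge 4 45 (out₃ 3 4 22 45) (merge 0 44 (in₃ 4 0 3 44) (
    merge 5 43 (path₂₊₂ 22 5 0 43) (merge 26 49 (out₃ 22 5 26 49) (merge 25 51 (in₃ 26 22 25 51) (
    merge 40 53 (in₃ 22 3 40 53) (merge 39 57 (path₂₊₂ 4 39 40 57) (split 2 46 (
     use 0 0 1 2 50 55 (merge 3 59 (out₃ 2 3 50 59) (merge 26 67 (in₃ 50 2 26 67) (
     merge 22 71 (path₂₊₂ 3 22 26 71) (merge 52 58 (in₃ 3 2 52 58) (split 25 57 (cycle₃ 26 50 25) (
     merge 54 57 (in₃ 52 25 54 57) (split 40 50 (cycle₃ 22 26 40) (split 1 60 (
      merge 8 64 (out₃ 1 2 8 64) (merge 10 63 (in₃ 8 1 10 63) (use 0 0 1 1 2 69 (merge 8 73 (out₃ 1 2 8 73) (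
      merge 10 72 (in₃ 8 1 10 72) (split 3 71 (path₂₊₂ 2 3 10 50) (merge 3 77 (out₃ 2 3 71 77) (
      split 0 80 (path₂₊₂ 79 0 4 3) (merge 0 74 (in₃ 1 0 74 80) (merge 4 78 (alternating₄ 3 4 0 78) (
      merge 12 80 (in₃ 1 0 12 80) (split 16 79 (cycle₃ 3 4 16) (merge 16 82 (in₃ 12 16 79 82) (
      merge 50 71 (path₂₊₂ 2 50 10 71) (merge 52 79 (in₃ 3 2 52 79) (merge 66 81 (in₃ 2 1 66 81) (
      split 65 85 (cycle₃ 8 65 10) (merge 68 85 (in₃ 66 65 68 85) (split 9 68 (path₂₊₂ 22 5 9 26) (
      merge 30 68 (out₃ 8 9 30 68) (split 4 66 (path₂₊₂ 30 4 39 28) (split 8 26 (path₂₊₂ 22 5 9 8) (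
      split 28 66 (alternating₄ 4 16 28 39) (use 0 0 1 10 11 67 (merge 8 71 (out₃ 10 8 11 71) (
      merge 1 70 (in₃ 8 1 10 70) (merge 0 69 (path₂₊₂ 11 0 1 69) (merge 13 79 (in₃ 11 10 13 79) (
      merge 9 83 (path₂₊₂ 8 9 13 83) (merge 40 75 (out₃ 11 0 40 75) (split 50 78 (path₂₊₂ 77 40 54 50) (
      merge 50 72 (in₃ 10 50 72 78) (merge 39 77 (in₃ 40 11 39 77) (merge 54 76 (alternating₄ 50 54 40 76) (
      merge 65 78 (in₃ 10 50 65 78) (use 0 0 1 11 40 81 (merge 0 85 (out₃ 11 0 40 85) (
      merge 5 84 (in₃ 0 5 11 84) (merge 22 83 (path₂₊₂ 40 22 5 83) (merge 39 93 (in₃ 40 11 39 93) (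
      merge 4 97 (path₂₊₂ 0 4 39 97) (merge 54 89 (out₃ 40 22 54 89) (split 10 86 (path₂₊₂ 50 10 90 54) (
      merge 10 92 (in₃ 11 10 86 92) (merge 50 91 (alternating₄ 91 10 50 54) (merge 13 86 (in₃ 11 10 13 86) (
      merge 65 94 (path₂₊₂ 39 65 10 94) (merge 80 90 (out₃ 13 11 80 90) (split 52 80 (cycle₃ 12 13 52) (
      use 0 0 1 12 13 81 (merge 1 85 (out₃ 12 1 13 85) (merge 0 84 (in₃ 1 0 12 84) (
      merge 11 83 (path₂₊₂ 13 11 0 83) (merge 9 93 (in₃ 13 9 12 93) (merge 8 97 (path₂₊₂ 1 8 9 97) (
      merge 25 94 (out₃ 9 13 25 94) (split 16 92 (path₂₊₂ 25 16 12 52) (merge 16 86 (in₃ 12 16 86 92) (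
      merge 52 92 (in₃ 12 16 52 92) (merge 54 91 (in₃ 52 25 54 91) (merge 80 89 (alternating₄ 54 80 13 89) (
      use 0 0 1 13 80 91 (merge 11 95 (out₃ 13 11 80 95) (merge 10 94 (in₃ 11 10 13 94) (
      merge 65 93 (path₂₊₂ 80 65 10 93) (merge 54 103 (in₃ 80 13 54 103) (
      merge 40 107 (path₂₊₂ 11 40 54 107) (merge 52 104 (out₃ 54 52 80 104) (split 9 102 (cycle₃ 9 25 52) (
      merge 9 96 (in₃ 13 9 96 102) (merge 12 102 (in₃ 13 9 12 102) (merge 16 101 (in₃ 12 16 52 101) (
      merge 25 100 (out₃ 9 13 25 100) (merge 27 99 (in₃ 25 9 27 99) (merge 27 90 (alternating₄ 80 27 16 90) (
      complete doyleHolt (0 ∷ 65 ∷ 12 ∷ 50 ∷ 9 ∷ 40 ∷ 27 ∷ 3 ∷ 30 ∷ 66 ∷ 1 ∷ 10 ∷ 13 ∷ 54 ∷ 25 ∷ 22 ∷ 28 ∷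
      4 ∷ 52 ∷ 26 ∷ 5 ∷ 39 ∷ 16 ∷ 2 ∷ 8 ∷ 11 ∷ 80 ∷
      [])))))))))))))))))))))))))))))))))))))))))))))))))))))))))))))))))))))))))))))
      (merge 1 66 (in₃ 2 1 60 66) (split 0 68 (path₂₊₂ 22 5 0 26) (merge 0 65 (in₃ 1 0 65 68) (
      split 4 63 (in₃ 4 0 3 50) (out₃ 0 1 4 63))))))))))))))
     (merge 2 52 (in₃ 3 2 46 52) (split 1 25 (alternating₄ 12 1 9 13) (split 1 54 (path₂₊₂ 11 0 1 40) (
     in₃ 2 1 25 54))))))))))))))))))))))))))))))))))))))))))))))

-- The first transfers send the arcs `(1 , 2)`, `(2 , 3)`, `(3 , 4)` and `(0 , 4)` of the cycle to
-- `(0 , 1)`. Nine of the twelve local configurations are contradictory; `certA₃` and `certA₁₁` end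
-- in the two Doyle-Holt orientations and `certA₈` in `roseArcs`.
certA : Certificate
certA =
  use 0 1 2 0 1 5 (split 0 3 (cycle₃ 0 1 2) (split 0 9 (cycle₃ 0 1 8) (split 1 4 (cycle₃ 1 2 3) (
  split 5 8 (cycle₃ 0 1 5) (split 2 8 (
   split 3 9 (path₂₊₂ 5 0 4 3) (use 0 2 3 0 1 10 (split 1 10 (cycle₃ 0 1 11) (split 11 14 (cycle₃ 0 1 11) (
   split 2 14 (
    split 5 11 (path₂₊₂ 10 2 9 5) (use 0 3 4 0 1 12 (split 0 12 (cycle₃ 0 13 14) (
    split 1 13 (cycle₃ 0 1 14) (split 5 14 (
     use 0 0 4 0 1 14 (split 0 17 (cycle₃ 0 15 16) (split 1 15 (cycle₃ 1 16 17) (merge 4 15 (out₃ 0 1 4 15) (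
     merge 12 17 (in₃ 1 0 12 17) (certA₀)))))) (merge 11 14 (in₃ 0 5 11 14) (use 0 0 4 0 1 14 (
     split 0 17 (cycle₃ 0 15 16) (split 1 15 (cycle₃ 1 16 17) (merge 4 15 (out₃ 0 1 4 15) (
     merge 12 17 (in₃ 1 0 12 17) (certA₁))))))))))))
    (split 5 11 (
     use 0 3 4 0 1 15 (split 0 15 (cycle₃ 0 16 17) (split 1 16 (cycle₃ 0 1 17) (split 5 17 (
      use 0 0 4 0 1 17 (split 0 20 (cycle₃ 0 18 19) (split 1 18 (cycle₃ 1 19 20) (
      merge 4 18 (out₃ 0 1 4 18) (merge 15 20 (in₃ 1 0 15 20) (certA₂)))))) (use 0 0 4 0 1 18 (
      split 0 21 (cycle₃ 0 19 20) (split 1 19 (cycle₃ 1 20 21) (merge 4 19 (out₃ 0 1 4 19) (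
      merge 15 21 (in₃ 1 0 15 21) (certA₃))))))))))
     (use 0 3 4 0 1 15 (split 0 15 (cycle₃ 0 16 17) (split 1 16 (cycle₃ 0 1 17) (split 5 17 (
      use 0 0 4 0 1 17 (split 0 20 (cycle₃ 0 18 19) (split 1 18 (cycle₃ 1 19 20) (
      merge 4 18 (out₃ 0 1 4 18) (merge 15 20 (in₃ 1 0 15 20) (certA₄)))))) (merge 11 17 (in₃ 0 5 11 17) (
      split 10 16 (path₂₊₂ 15 1 14 10) (use 0 0 4 0 1 17 (split 0 20 (cycle₃ 0 18 19) (
      split 1 18 (cycle₃ 1 19 20) (merge 4 18 (out₃ 0 1 4 18) (merge 15 20 (in₃ 1 0 15 20) (
      certA₅))))))))))))))))))
   (use 0 2 3 0 1 10 (split 1 10 (cycle₃ 0 1 11) (split 11 14 (cycle₃ 0 1 11) (split 2 14 (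
    split 5 11 (
     use 0 3 4 0 1 11 (split 0 11 (cycle₃ 0 12 13) (split 1 12 (cycle₃ 0 1 13) (split 5 13 (
      split 10 12 (path₂₊₂ 11 1 2 10) (use 0 0 4 0 1 13 (split 0 16 (cycle₃ 0 14 15) (
      split 1 14 (cycle₃ 1 15 16) (merge 4 14 (out₃ 0 1 4 14) (merge 11 16 (in₃ 1 0 11 16) (certA₆))))))) (
      use 0 0 4 0 1 14 (split 0 17 (cycle₃ 0 15 16) (split 1 15 (cycle₃ 1 16 17) (
      merge 4 15 (out₃ 0 1 4 15) (merge 11 17 (in₃ 1 0 11 17) (certA₇))))))))))
     (use 0 3 4 0 1 12 (split 0 12 (cycle₃ 0 13 14) (split 1 13 (cycle₃ 0 1 14) (split 5 14 (
      use 0 0 4 0 1 14 (split 0 17 (cycle₃ 0 15 16) (split 1 15 (cycle₃ 1 16 17) (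
      merge 4 15 (out₃ 0 1 4 15) (merge 12 17 (in₃ 1 0 12 17) (certA₈)))))) (merge 11 14 (in₃ 0 5 11 14) (
      split 10 13 (path₂₊₂ 12 1 2 10) (use 0 0 4 0 1 14 (split 0 17 (cycle₃ 0 15 16) (
      split 1 15 (cycle₃ 1 16 17) (merge 4 15 (out₃ 0 1 4 15) (merge 12 17 (in₃ 1 0 12 17) (
      certA₉)))))))))))))
    (merge 8 14 (out₃ 1 2 8 14) (split 5 11 (path₂₊₂ 10 5 9 8) (use 0 3 4 0 1 12 (
    split 0 12 (cycle₃ 0 13 14) (split 1 13 (cycle₃ 0 1 14) (split 5 14 (
     use 0 0 4 0 1 14 (split 0 17 (cycle₃ 0 15 16) (split 1 15 (cycle₃ 1 16 17) (merge 4 15 (out₃ 0 1 4 15) (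
     merge 12 17 (in₃ 1 0 12 17) (certA₁₀)))))) (merge 11 14 (in₃ 0 5 11 14) (
     split 10 13 (path₂₊₂ 12 1 8 10) (use 0 0 4 0 1 14 (split 0 17 (cycle₃ 0 15 16) (
     split 1 15 (cycle₃ 1 16 17) (merge 4 15 (out₃ 0 1 4 15) (merge 12 17 (in₃ 1 0 12 17) (
     certA₁₁)))))))))))))))))))))))

-- Here the 5-cycle itself is the only configuration ever transferred, and the single branch that is
-- not contradictory closes up to `roseArcs′`.
certB : Certificate
certB =
  use 0 2 3 0 1 5 (split 0 9 (transitive₃ 5 6 0) (split 1 4 (transitive₃ 1 2 3) (
  split 2 4 (transitive₃ 0 1 2) (split 6 9 (transitive₃ 6 0 1) (use 0 4 3 0 1 10 (
  split 0 12 (transitive₃ 10 11 0) (merge 9 12 (in₃ 1 0 9 12) (split 0 11 (transitive₃ 0 9 1) (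
  split 5 11 (path₃₊₁ 10 5 6 0) (split 6 10 (path₃₊₁ 5 6 11 9) (use 0 0 4 0 1 12 (
  split 1 13 (transitive₃ 1 14 15) (merge 4 13 (out₃ 0 1 4 13) (split 1 14 (transitive₃ 0 4 1) (
  split 2 15 (path₃₊₁ 4 14 2 3) (split 3 14 (path₃₊₁ 1 2 3 15) (use 0 1 2 0 1 16 (
  split 0 20 (transitive₃ 0 1 19) (split 1 20 (transitive₃ 16 0 1) (split 2 19 (
   split 6 16 (
    use 0 4 3 1 2 21 (split 1 23 (transitive₃ 21 22 1) (merge 20 23 (in₃ 2 1 20 23) (
    split 0 21 (path₃₊₁ 6 0 22 20) (merge 9 21 (in₃ 1 0 9 21) (split 1 22 (transitive₃ 1 20 2) (
    split 6 22 (path₃₊₁ 9 6 0 1) (use 0 0 4 1 2 23 (split 2 24 (transitive₃ 2 25 26) (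
    merge 15 24 (out₃ 1 2 15 24) (split 2 25 (transitive₃ 1 15 2) (split 3 26 (
     split 4 25 (path₃₊₁ 0 1 15 4) (in₃ 3 2 4 25)) (use 0 0 1 1 2 27 (split 2 31 (transitive₃ 2 29 30) (
     merge 15 31 (out₃ 1 2 15 31) (split 26 29 (path₃₊₁ 15 25 26 30) (merge 3 29 (out₃ 2 3 26 29) (
     split 3 15 (path₂₊₂ 0 1 3 4) (split 25 30 (path₃₊₁ 2 3 25 26) (use 0 1 2 1 15 31 (
     split 1 35 (transitive₃ 1 15 34) (split 15 35 (transitive₃ 31 1 15) (split 0 31 (
      split 4 35 (path₃₊₁ 4 14 15 34) (out₃ 0 1 4 35)) (merge 9 31 (in₃ 1 0 9 31) (
      merge 22 35 (out₃ 9 1 22 35) (split 20 34 (path₃₊₁ 1 15 20 2) (split 25 34 (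
       use 0 2 3 1 15 31 (split 1 35 (transitive₃ 31 32 1) (merge 14 35 (in₃ 15 1 14 35) (
       split 0 32 (path₃₊₁ 31 0 4 14) (merge 9 32 (in₃ 1 0 9 32) (split 4 31 (path₃₊₁ 0 4 9 1) (
       split 9 14 (path₃₊₁ 0 4 9 1) (split 5 31 (
        split 6 14 (cycle₃ 0 4 6) (out₃ 5 6 9 14)) (merge 11 31 (in₃ 9 5 11 31) (use 0 4 3 0 4 31 (
        split 0 32 (transitive₃ 0 33 4) (split 0 33 (transitive₃ 31 32 0) (split 6 31 (
         merge 20 32 (out₃ 6 0 20 32) (split 2 33 (path₃₊₁ 0 1 2 4) (use 0 2 3 0 4 34 (
         split 0 38 (transitive₃ 34 35 0) (merge 33 38 (in₃ 4 0 33 38) (split 6 35 (path₃₊₁ 34 6 20 33) (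
         merge 10 35 (in₃ 0 6 10 35) (split 10 33 (transitive₃ 10 0 4) (split 20 34 (path₃₊₁ 6 20 10 0) (
         use 0 0 4 2 3 35 (split 3 36 (transitive₃ 3 37 38) (merge 26 36 (out₃ 2 3 26 36) (
         split 3 37 (transitive₃ 2 26 3) (split 30 38 (
          split 15 37 (path₃₊₁ 1 2 26 15) (in₃ 30 3 15 37)) (use 0 0 1 2 3 39 (
          split 3 43 (transitive₃ 3 41 42) (merge 26 43 (out₃ 2 3 26 43) (split 38 41 (path₃₊₁ 26 37 38 42) (
          merge 30 41 (out₃ 3 30 38 41) (split 26 30 (path₃₊₁ 3 26 37 38) (split 37 42 (path₃₊₁ 3 30 37 38) (
          use 0 1 2 2 26 43 (split 2 47 (transitive₃ 2 26 46) (split 26 47 (transitive₃ 43 2 26) (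
          split 1 43 (
           split 15 47 (path₃₊₁ 15 25 26 46) (out₃ 1 2 15 47)) (merge 20 43 (in₃ 2 1 20 43) (
           merge 33 47 (out₃ 20 2 33 47) (split 4 46 (path₃₊₁ 2 26 4 3) (split 37 46 (
            use 0 0 4 3 30 43 (split 30 44 (transitive₃ 30 45 46) (merge 38 44 (out₃ 3 30 38 44) (
            split 30 45 (transitive₃ 3 38 30) (split 42 46 (
             split 26 45 (cycle₃ 38 26 37) (in₃ 42 26 30 45)) (use 0 0 1 3 30 47 (
             split 30 51 (transitive₃ 30 49 50) (merge 38 51 (out₃ 3 30 38 51) (
             split 46 49 (path₃₊₁ 38 45 46 50) (merge 42 49 (out₃ 30 42 46 49) (
             split 38 42 (path₃₊₁ 30 38 45 46) (split 45 50 (path₃₊₁ 30 42 45 46) (use 0 1 2 3 38 51 (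
             split 3 55 (transitive₃ 3 38 54) (split 38 55 (transitive₃ 51 3 38) (split 2 51 (
              split 26 55 (path₃₊₁ 26 37 38 54) (out₃ 2 3 26 55)) (merge 4 51 (in₃ 3 2 4 51) (
              merge 14 55 (out₃ 4 3 14 55) (split 15 54 (path₃₊₁ 3 38 15 30) (split 45 54 (
               use 0 4 3 4 14 51 (split 4 53 (transitive₃ 51 52 4) (merge 11 53 (in₃ 14 4 11 53) (
               split 0 51 (path₃₊₁ 10 0 52 11) (merge 33 51 (in₃ 4 0 33 51) (
               split 4 52 (transitive₃ 4 11 14) (merge 37 52 (out₃ 33 4 37 52) (
               split 10 37 (transitive₃ 34 33 10) (split 11 38 (path₃₊₁ 4 3 11 14) (use 0 1 2 5 6 51 (
               split 5 55 (transitive₃ 5 6 54) (split 6 55 (transitive₃ 51 5 6) (split 0 54 (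
                merge 10 55 (in₃ 0 6 10 55) (split 34 51 (
                 split 5 33 (cycle₃ 20 5 6) (out₃ 34 5 10 33)) (use 0 4 3 5 6 52 (
                 split 5 53 (transitive₃ 5 54 6) (split 5 54 (transitive₃ 52 53 5) (split 51 52 (
                  split 10 53 (path₃₊₁ 10 54 6 0) (out₃ 51 5 10 53)) (use 0 2 3 5 6 55 (
                  split 5 59 (transitive₃ 55 56 5) (merge 54 59 (in₃ 6 5 54 59) (
                  split 52 56 (path₃₊₁ 55 52 53 54) (merge 51 56 (in₃ 5 51 52 56) (use 0 1 2 5 9 56 (
                  split 5 60 (transitive₃ 5 9 59) (split 9 60 (transitive₃ 56 5 9) (split 1 59 (
                   split 0 60 (path₃₊₁ 56 5 6 0) (in₃ 1 0 9 60)) (merge 22 59 (out₃ 9 1 22 59) (split 51 56 (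
                    split 10 60 (path₃₊₁ 10 11 9 22) (out₃ 51 5 10 60)) (merge 52 56 (in₃ 5 51 52 56) (
                    merge 53 60 (out₃ 52 5 53 60) (split 22 54 (transitive₃ 22 6 20) (use 0 2 3 5 9 56 (
                    split 5 60 (transitive₃ 56 57 5) (merge 11 60 (in₃ 9 5 11 60) (
                    split 10 56 (path₃₊₁ 51 10 57 5) (merge 37 56 (in₃ 11 10 37 56) (
                    split 11 57 (path₃₊₁ 51 10 11 5) (merge 38 57 (out₃ 37 11 38 57) (
                    split 5 45 (path₃₊₁ 11 14 5 9) (merge 5 50 (out₃ 38 5 45 50) (
                    split 38 51 (path₃₊₁ 37 38 10 11) (merge 38 52 (in₃ 5 38 51 52) (
                    merge 42 51 (in₃ 5 38 42 51) (merge 45 53 (out₃ 38 5 45 53) (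
                    split 22 46 (path₃₊₁ 15 30 22 25) (merge 46 54 (out₃ 45 22 46 54) (
                    merge 30 55 (alternating₄ 30 42 55 46) (use 0 4 3 6 0 47 (
                    split 6 49 (transitive₃ 47 48 6) (merge 10 49 (in₃ 0 6 10 49) (
                    split 5 47 (path₃₊₁ 42 5 48 10) (split 42 48 (path₃₊₁ 47 42 5 6) (
                    merge 34 48 (in₃ 10 34 42 48) (merge 46 47 (in₃ 6 5 46 47) (
                    split 6 34 (path₃₊₁ 42 5 6 10) (use 0 0 4 15 25 47 (split 25 48 (transitive₃ 25 49 50) (
                    merge 30 48 (out₃ 15 25 30 48) (split 42 49 (path₃₊₁ 25 26 42 50) (
                    merge 46 49 (out₃ 30 42 46 49) (split 6 50 (path₃₊₁ 22 25 6 20) (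
                    merge 34 50 (out₃ 46 6 34 50) (split 25 46 (transitive₃ 15 30 25) (
                    split 26 34 (path₃₊₁ 30 46 26 42) (
                    complete rose′ (0 ∷ 6 ∷ 20 ∷ 22 ∷ 25 ∷ 15 ∷ 30 ∷ 3 ∷ 38 ∷ 37 ∷ 11 ∷ 10 ∷ 1 ∷ 46 ∷ 2 ∷
      45 ∷ 26 ∷ 14 ∷ 42 ∷ 4 ∷ 5 ∷ 33 ∷ 9 ∷ 34 ∷ [])))))))))))))))))))))))))))))))))))))))))))))))))))))))
                (merge 20 54 (out₃ 6 0 20 54) (split 22 55 (path₃₊₁ 51 5 9 22) (
                in₃ 20 6 22 55))))))))))))))))
               (merge 50 54 (out₃ 38 45 50 54) (split 14 42 (cycle₄ 15 25 26 14) (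
               in₃ 50 14 38 42)))))))))))))))))))))))
            (merge 42 46 (out₃ 26 37 42 46) (split 30 33 (cycle₄ 15 30 4 14) (
            in₃ 42 26 30 33))))))))))))))))))))))))))))))))
         (merge 10 31 (in₃ 0 6 10 31) (split 11 32 (path₃₊₁ 11 33 4 14) (out₃ 10 0 11 32))))))))))))))))
       (merge 30 34 (out₃ 15 25 30 34) (split 3 22 (cycle₃ 3 20 2) (
       in₃ 30 3 15 22))))))))))))))))))))))))))))))
    (merge 10 16 (in₃ 0 6 10 16) (split 11 20 (path₃₊₁ 11 9 1 2) (out₃ 10 0 11 20))))
   (merge 15 19 (out₃ 1 2 15 19) (split 14 20 (path₃₊₁ 16 0 4 14) (in₃ 15 1 14 20)))))))))))))))))))))))

-- One transfer suffices: if `(3 , 2)` goes to `(0 , 1)`, then `4` is fixed by the bound on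
-- successors, and the image `5` of `0` becomes a predecessor of `4`. It differs from `0` (else a
-- triangle) and from `3` (else a 4-cycle), so `4` has three predecessors.
certC : Certificate
certC =
  use 0 3 2 0 1 5 (split 1 4 (transitive₃ 3 1 2) (split 1 9 (transitive₃ 5 6 1) (merge 4 9 (out₃ 0 1 4 9) (
  split 0 3 (transitive₃ 0 1 2) (split 0 5 (transitive₃ 0 6 1) (split 3 5 (path₃₊₁ 3 6 1 2) (
  in₃ 4 0 3 5)))))))

-- Checker and certificate are closed terms, so the condition evaluates to the unit type.
validA : T (check (patternA ∷ []) patternA certA)
validA = tt

validB : T (check (patternB ∷ []) patternB certB)
validB = tt

validC : T (check (patternC ∷ []) patternC certC)
validC = tt

-- Lets cycles and sets of neighbours be given as lists without repetition.
lookup-unique : ∀ {A : Set} {xs : List A} → Unique xs → ∀ i j → lookup xs i ≡ lookup xs j → i ≡ j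
lookup-unique (_ ∷ _) zero    zero    _ = refl
lookup-unique (p ∷ _) zero    (suc j) e = ⊥-elim (All.lookup p (∈-lookup j) e)
lookup-unique (p ∷ _) (suc i) zero    e = ⊥-elim (All.lookup p (∈-lookup i) (sym e))
lookup-unique (_ ∷ u) (suc i) (suc j) e = cong suc (lookup-unique u i j e)

-- Finite graphs of girth at least five and their orientations

module SparseGraph (n : ℕ) (a : Fin n → Fin n → Bool)
  (simple : IsSimple (FinGraph n a)) (tetravalent : Tetravalent (FinGraph n a))
  (no₃ : ¬ Cycle (FinGraph n a) 3) (no₄ : ¬ Cycle (FinGraph n a) 4) where

  Γ : Graph
  Γ = FinGraph n a

  adj-sym : ∀ {x y} → Adj Γ x y → Adj Γ y x
  adj-sym {x} {y} h = trans (proj₁ simple y x) h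

  adj-irrefl : ∀ {x y} → Adj Γ x y → x ≢ y
  adj-irrefl {x} h refl with trans (sym h) (proj₂ simple x)
  ... | ()

  noTriangle : ∀ {x y z} → Adj Γ x y → Adj Γ y z → Adj Γ z x → ⊥
  noTriangle {x} {y} {z} xy yz zx = no₃ (lookup (x ∷ y ∷ z ∷ []) , lookup-unique unique , edges)
    where
    unique : Unique (x ∷ y ∷ z ∷ [])
    unique = (adj-irrefl xy ∷ adj-irrefl (adj-sym zx) ∷ []) ∷ (adj-irrefl yz ∷ []) ∷ [] ∷ []
    edges : ∀ i → Adj Γ (lookup (x ∷ y ∷ z ∷ []) i) (lookup (x ∷ y ∷ z ∷ []) (next Γ i))
    edges zero             = xy
    edges (suc zero)       = yz
    edges (suc (suc zero)) = zx

  -- Consecutive vertices differ because there are no loops; only the diagonals need hypotheses.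
  noSquare : ∀ {x y z w} → Adj Γ x y → Adj Γ y z → Adj Γ z w → Adj Γ w x → x ≢ z → y ≢ w → ⊥
  noSquare {x} {y} {z} {w} xy yz zw wx x≢z y≢w =
    no₄ (lookup (x ∷ y ∷ z ∷ w ∷ []) , lookup-unique unique , edges)
    where
    unique : Unique (x ∷ y ∷ z ∷ w ∷ [])
    unique = (adj-irrefl xy ∷ x≢z ∷ adj-irrefl (adj-sym wx) ∷ []) ∷ (adj-irrefl yz ∷ y≢w ∷ [])
           ∷ (adj-irrefl zw ∷ []) ∷ [] ∷ []
    edges : ∀ i → Adj Γ (lookup (x ∷ y ∷ z ∷ w ∷ []) i) (lookup (x ∷ y ∷ z ∷ w ∷ []) (next Γ i))
    edges zero                   = xy
    edges (suc zero)             = yz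
    edges (suc (suc zero))       = zw
    edges (suc (suc (suc zero))) = wx

  atMostFourNeighbours : ∀ {x} xs → Unique xs → All (Adj Γ x) xs → length xs ≤ 4
  atMostFourNeighbours {x} xs u hs = Fin.injective⇒≤ {f = proj₁ ∘ index} λ {i} {j} e →
    lookup-unique u i j (trans (sym (proj₂ (index i))) (trans (cong f e) (proj₂ (index j))))
    where
    f : Fin 4 → Fin n
    f = proj₁ (tetravalent x)
    index : ∀ i → ∃ λ k → f k ≡ lookup xs i
    index i = proj₂ (proj₂ (proj₂ (tetravalent x))) (lookup xs i) (All.lookup hs (∈-lookup i))

  -- If some vertex had three successors, all would, so none could have two predecessors:
  -- the arcs then inject into the vertices they point to, although there are three times as many.
  atMostTwoSuccessors : (R : Fin n → Fin n → Set) → (∀ {x y} → R x y → Adj Γ x y) →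
    (∀ {x y} → R x y → R y x → ⊥) →
    (∀ v w → Σ (Fin n → Fin n) λ g → (∀ x y → g x ≡ g y → x ≡ y) × (∀ {x y} → R x y → R (g x) (g y)) × g v ≡ w) →
    ∀ {v x y z} → R v x → R v y → R v z → x ≢ y → x ≢ z → y ≢ z → ⊥
  atMostTwoSuccessors R R⇒adj asym transitive {v} {x} {y} {z} vx vy vz x≢y x≢z y≢z =
    -- An injection from the `3 n` pairs of a vertex and an index into the `n` vertices is
    -- impossible, `n` being positive because `v` exists.
    <⇒≱ (m<m*n n 3 ⦃ Fin.nonZeroIndex v ⦄ (s≤s (s≤s z≤n)))
      (Fin.injective⇒≤ {f = uncurry successor ∘ remQuot {n} 3} λ {i} {j} e →
        trans (sym (Fin.combine-remQuot {n} 3 i))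
          (trans (cong (uncurry combine) (injective (remQuot 3 i) (remQuot 3 j) e)) (Fin.combine-remQuot {n} 3 j)))
    where
    xyz : List (Fin n)
    xyz = x ∷ y ∷ z ∷ []
    unique : Unique xyz
    unique = (x≢y ∷ x≢z ∷ []) ∷ (y≢z ∷ []) ∷ [] ∷ []
    arc : ∀ i → R v (lookup xyz i)
    arc zero             = vx
    arc (suc zero)       = vy
    arc (suc (suc zero)) = vz
    successor : Fin n → Fin 3 → Fin n
    successor w i = proj₁ (transitive v w) (lookup xyz i)
    isSuccessor : ∀ w i → R w (successor w i)
    isSuccessor w i with transitive v w
    ... | g , _ , hom , gv≡w = subst (λ t → R t (g (lookup xyz i))) gv≡w (hom (arc i))
    distinct : ∀ w i j → successor w i ≡ successor w j → i ≡ j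
    distinct w i j e = lookup-unique unique i j (proj₁ (proj₂ (transitive v w)) _ _ e)
    injective : ∀ p q → uncurry successor p ≡ uncurry successor q → p ≡ q
    injective (w , i) (w′ , j) e with w Fin.≟ w′
    ... | yes refl = cong (w ,_) (distinct w i j e)
    ... | no w≢w′  = ⊥-elim (<⇒≱ ≤-refl (atMostFourNeighbours five five-unique five-adj))
      where
      t = successor w i
      s : Fin 3 → Fin n
      s = successor t
      -- Two predecessors and three successors of `t`, disjoint by asymmetry: one neighbour too
      -- many.
      five : List (Fin n)
      five = w ∷ w′ ∷ tabulate s
      wt : R w t
      wt = isSuccessor w i
      w′t : R w′ t
      w′t = subst (R w′) (sym e) (isSuccessor w′ j)
      pred≢succ : ∀ {u} → R u t → ∀ k → u ≢ s k
      pred≢succ ut k refl = asym ut (isSuccessor t k)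
      five-unique : Unique five
      five-unique = (w≢w′ ∷ All.tabulate⁺ (pred≢succ wt)) ∷ All.tabulate⁺ (pred≢succ w′t)
                  ∷ Unique.tabulate⁺ (distinct t _ _)
      five-adj : All (Adj Γ t) five
      five-adj = adj-sym (R⇒adj wt) ∷ adj-sym (R⇒adj w′t) ∷ All.tabulate⁺ (R⇒adj ∘ isSuccessor t)

-- Recognising a graph from the arcs of one of its orientations

outs ins nbs : Arcs → Name → List Name
outs L i = concatMap (λ (x , y) → if x ≡ᵇ i then y ∷ [] else []) L
ins  L i = concatMap (λ (x , y) → if y ≡ᵇ i then x ∷ [] else []) L
nbs  L i = outs L i ++ ins L i

elem : Name → List Name → Bool
elem j = any (j ≡ᵇ_)

-- Names that girth five keeps apart from i: those at the end of a directed walk of length one or two,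
-- or of any walk of length three.
far : Arcs → Name → List Name
far L i = nbs L i ++ concatMap (outs L) (outs L i) ++ concatMap (ins L) (ins L i)
        ++ concatMap (nbs L) (concatMap (nbs L) (nbs L i))

apart : Pattern → List Name → Name → Name → Bool
apart P F i j = (i ≡ᵇ j) ∨ (elem j F ∨ contains P (i ≠ j))

-- The pattern is passed as an argument so that evaluation computes it only once.
separates : Pattern → ℕ → Arcs → Bool
separates P m L = all (λ i → all (apart P (far L i) i) (upTo m)) (upTo m)

record Orients {m : ℕ} (L : Arcs) (b : Fin m → Fin m → Bool) : Set where
  field
    edges     : ∀ i j → b i j ≡ elem (toℕ j) (nbs L (toℕ i))
    regular   : ∀ i → length (filter (λ j → b i j Bool.≟ true) (allFin m)) ≡ 4
    separated : T (separates (orientedPattern L) m L)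

record Enumeration (Δ : Graph) (m : ℕ) : Set where
  field
    enc     : V Δ → Fin m
    dec     : Fin m → V Δ
    dec-enc : ∀ x → dec (enc x) ≡ x
    enc-dec : ∀ i → enc (dec i) ≡ i

  matrix : Fin m → Fin m → Bool
  matrix i j = adj Δ (dec i) (dec j)

elem-sound : ∀ {P : Name → Set} j xs → T (elem j xs) → All P xs → P j
elem-sound {P} j (x ∷ xs) e (h ∷ hs) with ∨-split (j ≡ᵇ x) e
... | inj₁ p = subst P (sym (≡ᵇ⇒≡ j x p)) h
... | inj₂ p = elem-sound j xs p hs

concatMap⁺ : ∀ {A B : Set} {P : A → Set} {Q : B → Set} {f : A → List B} {xs} →
             (∀ {x} → P x → All Q (f x)) → All P xs → All Q (concatMap f xs)
concatMap⁺ h ps = All.concat⁺ (All.map⁺ (All.map h ps))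

module Recognition (n : ℕ) (a : Fin n → Fin n → Bool)
  (simple : IsSimple (FinGraph n a)) (connected : Connected (FinGraph n a))
  (tetravalent : Tetravalent (FinGraph n a))
  (no₃ : ¬ Cycle (FinGraph n a) 3) (no₄ : ¬ Cycle (FinGraph n a) 4)
  (O : Fin n → Fin n → Set) (O⇒adj : ∀ {x y} → O x y → Adj (FinGraph n a) x y)
  (asym : ∀ {x y} → O x y → O y x → ⊥) where

  open SparseGraph n a simple tetravalent no₃ no₄
  open Semantics (Fin._≟_ {n}) O

  module _ {m : ℕ} {Δ : Graph} (E : Enumeration Δ (suc m)) {L : Arcs} (orients : Orients L (Enumeration.matrix E))
    {ρ : Name → Fin n} (models : Models ρ (orientedPattern L)) where

    open Enumeration E
    open Orients orients

    arcs-sound : All (λ e → O (ρ (proj₁ e)) (ρ (proj₂ e))) L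
    arcs-sound = All.map⁻ (All.++⁻ˡ (map (λ (x , y) → x ⇒ y) L) models)

    outs-sound : ∀ i → All (λ j → O (ρ i) (ρ j)) (outs L i)
    outs-sound i = concatMap⁺ (λ {e} → pick e) arcs-sound
      where
      pick : ∀ e → O (ρ (proj₁ e)) (ρ (proj₂ e)) → All (λ j → O (ρ i) (ρ j)) (if proj₁ e ≡ᵇ i then proj₂ e ∷ [] else [])
      pick (x , y) h with x ≡ᵇ i in eq
      ... | true  = subst (λ t → O (ρ t) (ρ y)) (≡ᵇ⇒≡ x i (subst T (sym eq) tt)) h ∷ []
      ... | false = []

    ins-sound : ∀ i → All (λ j → O (ρ j) (ρ i)) (ins L i)
    ins-sound i = concatMap⁺ (λ {e} → pick e) arcs-sound
      where
      pick : ∀ e → O (ρ (proj₁ e)) (ρ (proj₂ e)) → All (λ j → O (ρ j) (ρ i)) (if proj₂ e ≡ᵇ i then proj₁ e ∷ [] else [])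
      pick (x , y) h with y ≡ᵇ i in eq
      ... | true  = subst (λ t → O (ρ x) (ρ t)) (≡ᵇ⇒≡ y i (subst T (sym eq) tt)) h ∷ []
      ... | false = []

    nbs-sound : ∀ i → All (λ j → Adj Γ (ρ i) (ρ j)) (nbs L i)
    nbs-sound i = All.++⁺ (All.map O⇒adj (outs-sound i)) (All.map (adj-sym ∘ O⇒adj) (ins-sound i))

    -- In the four parts of `far`, a coincidence would create a loop, a pair of opposite arcs (for
    -- both kinds of directed walk), or a triangle.
    far-sound : ∀ i → All (λ j → ρ i ≢ ρ j) (far L i)
    far-sound i = All.++⁺ (All.map adj-irrefl (nbs-sound i))
      (All.++⁺ (concatMap⁺ (λ {w} iw → All.map (λ wj e → asym iw (subst (O (ρ w)) (sym e) wj)) (outs-sound w)) (outs-sound i))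
      (All.++⁺ (concatMap⁺ (λ {w} wi → All.map (λ jw e → asym wi (subst (λ t → O t (ρ w)) (sym e) jw)) (ins-sound w)) (ins-sound i))
        (concatMap⁺ {P = λ z → ∃ λ w → Adj Γ (ρ i) w × Adj Γ w (ρ z)}
          (λ {z} (_ , iw , wz) → All.map (λ {j} zj e → noTriangle iw wz (subst (Adj Γ (ρ z)) (sym e) zj)) (nbs-sound z))
          (concatMap⁺ (λ {w} iw → All.map (λ wz → ρ w , iw , wz) (nbs-sound w)) (nbs-sound i)))))

    f : Fin (suc m) → Fin n
    f i = ρ (toℕ i)

    -- By `separated`, distinct names are either far from each other or siblings, whose inequation
    -- belongs to the pattern.
    f-injective : ∀ {i j} → f i ≡ f j → i ≡ j
    f-injective {i} {j} e with ∨-split (toℕ i ≡ᵇ toℕ j)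
      (All.applyUpTo⁻ id (suc m) (All.all⁺ _ _ (All.applyUpTo⁻ id (suc m) (All.all⁺ _ _ separated) (Fin.toℕ<n i))) (Fin.toℕ<n j))
    ... | inj₁ p = Fin.toℕ-injective (≡ᵇ⇒≡ _ _ p)
    ... | inj₂ q with ∨-split (elem (toℕ j) (far L (toℕ i))) q
    ...   | inj₁ p = ⊥-elim (elem-sound (toℕ j) (far L (toℕ i)) p (far-sound (toℕ i)) e)
    ...   | inj₂ p = ⊥-elim (contains-sound (orientedPattern L) (toℕ i ≠ toℕ j) p models e)

    f-adj : ∀ {i j} → matrix i j ≡ true → Adj Γ (f i) (f j)
    f-adj {i} {j} h = elem-sound (toℕ j) (nbs L (toℕ i)) (subst T (trans (sym h) (edges i j)) tt) (nbs-sound (toℕ i))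

    -- The images of the four neighbours of `i` are already four distinct neighbours of `f i`, so
    -- any other `w` would be a fifth.
    f-lifts : ∀ i {w} → Adj Γ (f i) w → ∃ λ j → f j ≡ w × matrix i j ≡ true
    f-lifts i {w} iw with Fin.any? (λ j → (f j Fin.≟ w) ×-dec (matrix i j Bool.≟ true))
    ... | yes found = found
    ... | no ¬found = ⊥-elim (<⇒≱ ≤-refl (subst (λ l → suc l ≤ 4) (trans (List.length-map f ns) (regular i))
            (atMostFourNeighbours (w ∷ map f ns) unique (iw ∷ All.map⁺ (All.map f-adj ns-adj)))))
      where
      ns : List (Fin (suc m))
      ns = filter (λ j → matrix i j Bool.≟ true) (allFin (suc m))
      ns-adj : All (λ j → matrix i j ≡ true) ns
      ns-adj = All.all-filter (λ j → matrix i j Bool.≟ true) (allFin (suc m))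
      unique : Unique (w ∷ map f ns)
      unique = All.map⁺ (All.map (λ ij e → ¬found (_ , sym e , ij)) ns-adj)
             ∷ Unique.map⁺ f-injective (Unique.filter⁺ (λ j → matrix i j Bool.≟ true) (Unique.allFin⁺ (suc m)))

    f-surjective : ∀ {v} → Walk Γ (f zero) v → ∃ λ j → f j ≡ v
    f-surjective here = zero , refl
    f-surjective (step p vw) with f-surjective p
    ... | i , refl with f-lifts i vw
    ...   | j , fj , _ = j , fj

    f⁻ : Fin n → Fin (suc m)
    f⁻ v = proj₁ (f-surjective (connected (f zero) v))

    f-f⁻ : ∀ v → f (f⁻ v) ≡ v
    f-f⁻ v = proj₂ (f-surjective (connected (f zero) v))

    -- An edge between images lifts to an edge at `i`, and injectivity identifies its other end with
    -- `j`; hence Γ has no extra edges.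
    f-matrix : ∀ i j → matrix i j ≡ a (f i) (f j)
    f-matrix i j with matrix i j in eq | a (f i) (f j) in eq′
    ... | true  | true  = refl
    ... | false | false = refl
    ... | true  | false = trans (sym (f-adj eq)) eq′
    ... | false | true  with f-lifts i eq′
    ...   | k , fk , ik with f-injective fk
    ...     | refl = trans (sym eq) ik

    isomorphic : Γ ≅ Δ
    isomorphic = dec ∘ f⁻ , f ∘ enc
      , (λ x → trans (cong f (enc-dec (f⁻ x))) (f-f⁻ x))
      , (λ y → trans (cong dec (f-injective (f-f⁻ (f (enc y))))) (dec-enc y))
      , (λ u v → trans (f-matrix (f⁻ u) (f⁻ v)) (cong₂ a (f-f⁻ u) (f-f⁻ v)))

-- Numbering the two graphs and matching them with their arc lists

doyleHoltEnum : Enumeration (Xo 3 9 4) 27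
doyleHoltEnum = record
  { enc = uncurry combine ; dec = remQuot {3} 9
  ; dec-enc = uncurry Fin.remQuot-combine ; enc-dec = Fin.combine-remQuot {3} 9 }

roseEnum : Enumeration (Rose 12 5 2) 24
roseEnum = record
  { enc = join 12 12 ; dec = splitAt 12
  ; dec-enc = Fin.splitAt-join 12 12 ; enc-dec = Fin.join-splitAt 12 12 }

regular? : ∀ {m} (b : Fin m → Fin m → Bool) → Dec (∀ i → length (filter (λ j → b i j Bool.≟ true) (allFin m)) ≡ 4)
regular? b = Fin.all? λ i → length (filter (λ j → b i j Bool.≟ true) (allFin _)) ℕ.≟ 4

matches? : ∀ {m} (L : Arcs) (b : Fin m → Fin m → Bool) → Dec (∀ i j → b i j ≡ elem (toℕ j) (nbs L (toℕ i)))
matches? L b = Fin.all? λ i → Fin.all? λ j → b i j Bool.≟ elem (toℕ j) (nbs L (toℕ i))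

doyleHolt-orients : Orients doyleHoltArcs (Enumeration.matrix doyleHoltEnum)
doyleHolt-orients = record
  { edges = from-yes (matches? doyleHoltArcs (Enumeration.matrix doyleHoltEnum))
  ; regular = from-yes (regular? (Enumeration.matrix doyleHoltEnum)) ; separated = tt }

doyleHolt⁻-orients : Orients (map swap doyleHoltArcs) (Enumeration.matrix doyleHoltEnum)
doyleHolt⁻-orients = record
  { edges = from-yes (matches? (map swap doyleHoltArcs) (Enumeration.matrix doyleHoltEnum))
  ; regular = from-yes (regular? (Enumeration.matrix doyleHoltEnum)) ; separated = tt }

rose-orients : Orients roseArcs (Enumeration.matrix roseEnum)
rose-orients = record
  { edges = from-yes (matches? roseArcs (Enumeration.matrix roseEnum))
  ; regular = from-yes (regular? (Enumeration.matrix roseEnum)) ; separated = tt }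

rose′-orients : Orients roseArcs′ (Enumeration.matrix roseEnum)
rose′-orients = record
  { edges = from-yes (matches? roseArcs′ (Enumeration.matrix roseEnum))
  ; regular = from-yes (regular? (Enumeration.matrix roseEnum)) ; separated = tt }

-- Half-arc-transitive groups and their orientations

module HalfArcTransitiveGroup (n : ℕ) (a : Fin n → Fin n → Bool)
  (G : (Fin n → Fin n) → Set) (hat : HalfArcTransitive (FinGraph n a) G)
  (u v : Fin n) (uv : Adj (FinGraph n a) u v) where

  private
    Γ : Graph
    Γ = FinGraph n a

  open IsSubgroupOfAut (proj₁ hat)

  O : Fin n → Fin n → Set
  O = ArcOrbit Γ G u v

  O⇒adj : ∀ {x y} → O x y → Adj Γ x y
  O⇒adj (g , Gg , refl , refl) = trans (proj₂ (proj₂ (aut g Gg)) u v) uv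

  preserves : ∀ {g} → G g → ∀ {x y} → O x y → O (g x) (g y)
  preserves {g} Gg (h , Gh , refl , refl) = g ∘ h , comp g h Gg Gh , refl , refl

  injective : ∀ {g} → G g → ∀ x y → g x ≡ g y → x ≡ y
  injective {g} Gg = proj₁ (aut g Gg)

  moves : ∀ {x y x′ y′} → O x y → O x′ y′ → ∃ λ g → G g × g x ≡ x′ × g y ≡ y′
  moves (g , Gg , refl , refl) (h , Gh , refl , refl) with inv g Gg
  ... | g⁻ , Gg⁻ , g⁻g = h ∘ g⁻ , comp h g⁻ Gh Gg⁻ , cong h (g⁻g u) , cong h (g⁻g v)

  orient : ∀ {x y} → Adj Γ x y → O x y ⊎ O y x
  orient {x} {y} xy with proj₁ (proj₂ (proj₂ hat)) u v x y uv xy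
  ... | g , Gg , inj₁ (gu , gv) = inj₁ (g , Gg , gu , gv)
  ... | g , Gg , inj₂ (gu , gv) = inj₂ (g , Gg , gu , gv)

  -- If the orbit contained an arc and its reverse, it would contain all arcs: of any `p`, `q` one
  -- direction lies in it, say `(q , p)`, and the element taking `(x , y)` there takes `(y , x)` to
  -- `(p , q)`. Then G would be arc-transitive.
  asym : ∀ {x y} → O x y → O y x → ⊥
  asym xy yx = proj₂ (proj₂ (proj₂ hat)) λ _ _ _ _ pq rs → moves (all-arcs pq) (all-arcs rs)
    where
    all-arcs : ∀ {p q} → Adj Γ p q → O p q
    all-arcs pq with orient pq
    ... | inj₁ o = o
    ... | inj₂ o with moves xy o
    ...   | g , Gg , refl , refl = preserves Gg yx

  open Semantics (Fin._≟_ {n}) O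

  homogeneous : ∀ {x y x′ y′} → O x y → O x′ y′ → Embedding x y x′ y′
  homogeneous xy xy′ with moves xy xy′
  ... | g , Gg , gx , gy = g , injective Gg , preserves Gg , gx , gy

  transitive : ∀ x y → ∃ λ g → (∀ x y → g x ≡ g y → x ≡ y) × (∀ {x y} → O x y → O (g x) (g y)) × g x ≡ y
  transitive x y with proj₁ (proj₂ hat) x y
  ... | g , Gg , gx = g , injective Gg , preserves Gg , gx

-- From an undirected 5-cycle to the two graphs

module Classification (n : ℕ) (a : Fin n → Fin n → Bool)
  (simple : IsSimple (FinGraph n a)) (connected : Connected (FinGraph n a))
  (tetravalent : Tetravalent (FinGraph n a))
  (no₃ : ¬ Cycle (FinGraph n a) 3) (no₄ : ¬ Cycle (FinGraph n a) 4)
  (G : (Fin n → Fin n) → Set) (hat : HalfArcTransitive (FinGraph n a) G)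
  (u v : Fin n) (uv : Adj (FinGraph n a) u v) where

  open HalfArcTransitiveGroup n a G hat u v uv
  open SparseGraph n a simple tetravalent no₃ no₄
  open Recognition n a simple connected tetravalent no₃ no₄ O O⇒adj asym
  open Semantics (Fin._≟_ {n}) O

  Goal : Set
  Goal = (Γ ≅ Xo 3 9 4) ⊎ (Γ ≅ Rose 12 5 2)

  directed² : ∀ {x y z} → O x y → O y z → x ≢ z
  directed² xy yz refl = asym xy yz

  closes : ∀ p ρ → Models ρ (patternOf p) → Goal
  closes Cycle₃ ρ (p ∷ q ∷ r ∷ []) = ⊥-elim (noTriangle (O⇒adj p) (O⇒adj q) (O⇒adj r))
  closes Transitive₃ ρ (p ∷ q ∷ r ∷ []) = ⊥-elim (noTriangle (O⇒adj p) (O⇒adj q) (adj-sym (O⇒adj r)))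
  closes Cycle₄ ρ (p ∷ q ∷ r ∷ s ∷ []) =
    ⊥-elim (noSquare (O⇒adj p) (O⇒adj q) (O⇒adj r) (O⇒adj s) (directed² p q) (directed² q r))
  closes Path₃₊₁ ρ (p ∷ q ∷ r ∷ s ∷ []) =
    ⊥-elim (noSquare (O⇒adj p) (O⇒adj q) (O⇒adj r) (adj-sym (O⇒adj s)) (directed² p q) (directed² q r))
  closes Path₂₊₂ ρ (p ∷ q ∷ r ∷ s ∷ d ∷ []) =
    ⊥-elim (noSquare (O⇒adj p) (O⇒adj q) (adj-sym (O⇒adj s)) (adj-sym (O⇒adj r)) (directed² p q) d)
  closes Alternating₄ ρ (p ∷ q ∷ r ∷ s ∷ d ∷ e ∷ []) =
    ⊥-elim (noSquare (O⇒adj p) (adj-sym (O⇒adj q)) (O⇒adj r) (adj-sym (O⇒adj s)) d e)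
  closes Out₃ ρ (p ∷ q ∷ r ∷ d ∷ e ∷ f ∷ []) =
    ⊥-elim (atMostTwoSuccessors O O⇒adj asym transitive p q r d e f)
  -- Predecessors are successors for the reversed orientation, which has the same symmetries.
  closes In₃ ρ (p ∷ q ∷ r ∷ d ∷ e ∷ f ∷ []) =
    ⊥-elim (atMostTwoSuccessors (flip O) (adj-sym ∘ O⇒adj) asym
      (λ x y → let (g , inj , hom , gx) = transitive x y in g , inj , hom , gx) p q r d e f)
  closes (Complete doyleHolt)  ρ h = inj₁ (isomorphic doyleHoltEnum doyleHolt-orients h)
  closes (Complete doyleHolt⁻) ρ h = inj₁ (isomorphic doyleHoltEnum doyleHolt⁻-orients h)
  closes (Complete rose)       ρ h = inj₂ (isomorphic roseEnum rose-orients h)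
  closes (Complete rose′)      ρ h = inj₂ (isomorphic roseEnum rose′-orients h)

  open Soundness homogeneous patternOf closes

  valuation : (x₀ x₁ x₂ x₃ x₄ : Fin n) → Name → Fin n
  valuation x₀ x₁ x₂ x₃ x₄ 0 = x₀
  valuation x₀ x₁ x₂ x₃ x₄ 1 = x₁
  valuation x₀ x₁ x₂ x₃ x₄ 2 = x₂
  valuation x₀ x₁ x₂ x₃ x₄ 3 = x₃
  -- The patterns of the three types only mention the names 0 to 4; all others may have any value.
  valuation x₀ x₁ x₂ x₃ x₄ _ = x₄

  -- The cycle enters twice: as the initial configuration and as the first recorded part, ready to
  -- be transferred.
  typeA : ∀ {x₀ x₁ x₂ x₃ x₄} → O x₀ x₁ → O x₁ x₂ → O x₂ x₃ → O x₃ x₄ → O x₀ x₄ → Goal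
  typeA {x₀} {x₁} {x₂} {x₃} {x₄} p q r s t = sound certA validA ((ρ , h) ∷ []) h
    where
    ρ = valuation x₀ x₁ x₂ x₃ x₄
    h : Models ρ patternA
    h = p ∷ q ∷ r ∷ s ∷ t ∷ []

  typeB : ∀ {x₀ x₁ x₂ x₃ x₄} → O x₀ x₁ → O x₁ x₂ → O x₂ x₃ → O x₄ x₃ → O x₀ x₄ → Goal
  typeB {x₀} {x₁} {x₂} {x₃} {x₄} p q r s t = sound certB validB ((ρ , h) ∷ []) h
    where
    ρ = valuation x₀ x₁ x₂ x₃ x₄
    h : Models ρ patternB
    h = p ∷ q ∷ r ∷ s ∷ t ∷ []

  typeC : ∀ {x₀ x₁ x₂ x₃ x₄} → O x₀ x₁ → O x₁ x₂ → O x₃ x₂ → O x₃ x₄ → O x₀ x₄ → Goal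
  typeC {x₀} {x₁} {x₂} {x₃} {x₄} p q r s t = sound certC validC ((ρ , h) ∷ []) h
    where
    ρ = valuation x₀ x₁ x₂ x₃ x₄
    h : Models ρ patternC
    h = p ∷ q ∷ r ∷ s ∷ t ∷ []

  Edge : (Fin 5 → Fin n) → Fin 5 → Set
  Edge c i = O (c i) (c (next Γ i)) ⊎ O (c (next Γ i)) (c i)

  -- The type is determined by the edges pointing in the minority direction: none (directed), one
  -- (A), two adjacent (B) or two non-adjacent (C). The order of the arguments chooses the starting
  -- vertex and the sense of traversal.
  classify : ∀ {c} → Edge c zero → Edge c (suc zero) → Edge c (suc (suc zero)) →
    Edge c (suc (suc (suc zero))) → Edge c (suc (suc (suc (suc zero)))) →
    (∀ i → DirectedAt Γ O c i) ⊎ Goal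
  classify (inj₁ p) (inj₁ q) (inj₁ r) (inj₁ s) (inj₁ t) =
    inj₁ λ { zero → inj₁ (p , q) ; (suc zero) → inj₁ (q , r)
           ; (suc (suc zero)) → inj₁ (r , s) ; (suc (suc (suc zero))) → inj₁ (s , t)
           ; (suc (suc (suc (suc zero)))) → inj₁ (t , p) }
  classify (inj₁ p) (inj₁ q) (inj₁ r) (inj₁ s) (inj₂ t) = inj₂ (typeA p q r s t)
  classify (inj₁ p) (inj₁ q) (inj₁ r) (inj₂ s) (inj₁ t) = inj₂ (typeA t p q r s)
  classify (inj₁ p) (inj₁ q) (inj₁ r) (inj₂ s) (inj₂ t) = inj₂ (typeB p q r s t)
  classify (inj₁ p) (inj₁ q) (inj₂ r) (inj₁ s) (inj₁ t) = inj₂ (typeA s t p q r)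
  classify (inj₁ p) (inj₁ q) (inj₂ r) (inj₁ s) (inj₂ t) = inj₂ (typeC p q r s t)
  classify (inj₁ p) (inj₁ q) (inj₂ r) (inj₂ s) (inj₁ t) = inj₂ (typeB t p q r s)
  classify (inj₁ p) (inj₁ q) (inj₂ r) (inj₂ s) (inj₂ t) = inj₂ (typeB t s r q p)
  classify (inj₁ p) (inj₂ q) (inj₁ r) (inj₁ s) (inj₁ t) = inj₂ (typeA r s t p q)
  classify (inj₁ p) (inj₂ q) (inj₁ r) (inj₁ s) (inj₂ t) = inj₂ (typeC r s t p q)
  classify (inj₁ p) (inj₂ q) (inj₁ r) (inj₂ s) (inj₁ t) = inj₂ (typeC t p q r s)
  classify (inj₁ p) (inj₂ q) (inj₁ r) (inj₂ s) (inj₂ t) = inj₂ (typeC t s r q p)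
  classify (inj₁ p) (inj₂ q) (inj₂ r) (inj₁ s) (inj₁ t) = inj₂ (typeB s t p q r)
  classify (inj₁ p) (inj₂ q) (inj₂ r) (inj₁ s) (inj₂ t) = inj₂ (typeC r q p t s)
  classify (inj₁ p) (inj₂ q) (inj₂ r) (inj₂ s) (inj₁ t) = inj₂ (typeB s r q p t)
  classify (inj₁ p) (inj₂ q) (inj₂ r) (inj₂ s) (inj₂ t) = inj₂ (typeA t s r q p)
  classify (inj₂ p) (inj₁ q) (inj₁ r) (inj₁ s) (inj₁ t) = inj₂ (typeA q r s t p)
  classify (inj₂ p) (inj₁ q) (inj₁ r) (inj₁ s) (inj₂ t) = inj₂ (typeB q r s t p)
  classify (inj₂ p) (inj₁ q) (inj₁ r) (inj₂ s) (inj₁ t) = inj₂ (typeC q r s t p)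
  classify (inj₂ p) (inj₁ q) (inj₁ r) (inj₂ s) (inj₂ t) = inj₂ (typeB p t s r q)
  classify (inj₂ p) (inj₁ q) (inj₂ r) (inj₁ s) (inj₁ t) = inj₂ (typeC s t p q r)
  classify (inj₂ p) (inj₁ q) (inj₂ r) (inj₁ s) (inj₂ t) = inj₂ (typeC p t s r q)
  classify (inj₂ p) (inj₁ q) (inj₂ r) (inj₂ s) (inj₁ t) = inj₂ (typeC s r q p t)
  classify (inj₂ p) (inj₁ q) (inj₂ r) (inj₂ s) (inj₂ t) = inj₂ (typeA p t s r q)
  classify (inj₂ p) (inj₂ q) (inj₁ r) (inj₁ s) (inj₁ t) = inj₂ (typeB r s t p q)
  classify (inj₂ p) (inj₂ q) (inj₁ r) (inj₁ s) (inj₂ t) = inj₂ (typeB q p t s r)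
  classify (inj₂ p) (inj₂ q) (inj₁ r) (inj₂ s) (inj₁ t) = inj₂ (typeC q p t s r)
  classify (inj₂ p) (inj₂ q) (inj₁ r) (inj₂ s) (inj₂ t) = inj₂ (typeA q p t s r)
  classify (inj₂ p) (inj₂ q) (inj₂ r) (inj₁ s) (inj₁ t) = inj₂ (typeB r q p t s)
  classify (inj₂ p) (inj₂ q) (inj₂ r) (inj₁ s) (inj₂ t) = inj₂ (typeA r q p t s)
  classify (inj₂ p) (inj₂ q) (inj₂ r) (inj₂ s) (inj₁ t) = inj₂ (typeA s r q p t)
  classify (inj₂ p) (inj₂ q) (inj₂ r) (inj₂ s) (inj₂ t) =
    inj₁ λ { zero → inj₂ (p , q) ; (suc zero) → inj₂ (q , r)
           ; (suc (suc zero)) → inj₂ (r , s) ; (suc (suc (suc zero))) → inj₂ (s , t)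
           ; (suc (suc (suc (suc zero)))) → inj₂ (t , p) }

  undirected⇒goal : (C : Cycle Γ 5) → UndirectedCycle Γ O C → Goal
  undirected⇒goal (c , _ , edges) undirected
    with classify {c} (orient (edges _)) (orient (edges _)) (orient (edges _)) (orient (edges _)) (orient (edges _))
  ... | inj₁ directed = ⊥-elim (undirected directed)
  ... | inj₂ goal     = goal

-- Half-arc-transitive groups of the two graphs

iterate : ∀ {A : Set} → (A → A) → ℕ → A → A
iterate f zero    = id
iterate f (suc k) = f ∘ iterate f k

-- The vertex cycle (next sink) is to be a sink of the cycle, which makes the cycle undirected.
record SymmetryData (m : ℕ) : Set where
  field
    o     : Fin m → Fin m → Bool
    gen   : Fin 3 → Fin m → Fin m
    p q   : Fin m
    cycle : Fin 5 → Fin m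
    sink  : Fin 5

  word : ℕ → ℕ → ℕ → Fin m → Fin m
  word k l s = iterate (gen zero) k ∘ iterate (gen (suc zero)) l ∘ iterate (gen (suc (suc zero))) s

record Symmetries {m : ℕ} (b : Fin m → Fin m → Bool) (D : SymmetryData m) : Set where
  open SymmetryData D
  private
    next′ : Fin 5 → Fin 5
    next′ = next (FinGraph m b)
  field
    edges          : ∀ i j → b i j ≡ o i j ∨ o j i
    antisym        : ∀ i j → o i j ∧ o j i ≡ false
    gen-inj        : ∀ r i j → gen r i ≡ gen r j → i ≡ j
    gen-surj       : ∀ r j → ∃ λ i → gen r i ≡ j
    gen-pres       : ∀ r i j → o (gen r i) (gen r j) ≡ o i j
    successor      : ∀ i → ∃ λ j → o i j ≡ true
    -- The bounds serve both graphs: the first generator has order 9 or 12, the second 3 or 2, and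
    -- the third 2.
    arc-transitive : ∀ i j → o i j ≡ true →
      ∃ λ (k : Fin 12) → ∃ λ (l : Fin 3) → ∃ λ (s : Fin 2) →
        word (toℕ k) (toℕ l) (toℕ s) p ≡ i × word (toℕ k) (toℕ l) (toℕ s) q ≡ j
    pq             : o p q ≡ true
    cycle-inj      : ∀ i j → cycle i ≡ cycle j → i ≡ j
    cycle-edges    : ∀ i → b (cycle i) (cycle (next′ i)) ≡ true
    sink-in        : o (cycle (next′ sink)) (cycle sink) ≡ false
    sink-out       : o (cycle (next′ sink)) (cycle (next′ (next′ sink))) ≡ false

module Converse (n : ℕ) (a : Fin n → Fin n → Bool) {m : ℕ} {Δ : Graph} (E : Enumeration Δ m)
  {D : SymmetryData m} (S : Symmetries (Enumeration.matrix E) D) (iso : FinGraph n a ≅ Δ) where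

  open Enumeration E
  open SymmetryData D
  open Symmetries S

  Γ : Graph
  Γ = FinGraph n a

  φ : Fin n → Fin m
  φ = enc ∘ proj₁ iso

  φ⁻ : Fin m → Fin n
  φ⁻ = proj₁ (proj₂ iso) ∘ dec

  φ⁻φ : ∀ x → φ⁻ (φ x) ≡ x
  φ⁻φ x = trans (cong (proj₁ (proj₂ iso)) (dec-enc (proj₁ iso x))) (proj₁ (proj₂ (proj₂ iso)) x)

  φφ⁻ : ∀ i → φ (φ⁻ i) ≡ i
  φφ⁻ i = trans (cong enc (proj₁ (proj₂ (proj₂ (proj₂ iso))) (dec i))) (enc-dec i)

  φ-adj : ∀ x y → matrix (φ x) (φ y) ≡ a x y
  φ-adj x y = trans (cong₂ (adj Δ) (dec-enc _) (dec-enc _)) (proj₂ (proj₂ (proj₂ (proj₂ iso))) x y)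

  ω : Fin n → Fin n → Bool
  ω x y = o (φ x) (φ y)

  ω-adj : ∀ x y → a x y ≡ ω x y ∨ ω y x
  ω-adj x y = trans (sym (φ-adj x y)) (edges (φ x) (φ y))

  -- Taking every automorphism that preserves the orientation makes the group laws immediate; the
  -- generators are only needed for transitivity.
  G : (Fin n → Fin n) → Set
  G g = IsAut Γ g × (∀ x y → ω (g x) (g y) ≡ ω x y)

  subgroup : IsSubgroupOfAut Γ G
  subgroup = record
    { ext    = λ g h g≗h ((inj , surj , hom) , pres) →
        ( (λ x y e → inj x y (trans (g≗h x) (trans e (sym (g≗h y)))))
        , (λ w → proj₁ (surj w) , trans (sym (g≗h _)) (proj₂ (surj w)))
        , (λ x y → trans (sym (cong₂ a (g≗h x) (g≗h y))) (hom x y)))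
        , (λ x y → trans (sym (cong₂ ω (g≗h x) (g≗h y))) (pres x y))
    ; aut    = λ _ → proj₁
    ; has-id = ((λ _ _ e → e) , (λ w → w , refl) , (λ _ _ → refl)) , (λ _ _ → refl)
    ; comp   = λ g h ((inj , surj , hom) , pres) ((inj′ , surj′ , hom′) , pres′) →
        ( (λ x y e → inj′ x y (inj _ _ e))
        , (λ w → let (x , gx) = surj w ; (y , hy) = surj′ x in y , trans (cong g hy) gx)
        , (λ x y → trans (hom _ _) (hom′ x y)))
        , (λ x y → trans (pres _ _) (pres′ x y))
    ; inv    = λ g ((inj , surj , hom) , pres) →
        let g⁻ = λ w → proj₁ (surj w)
            gg⁻ : ∀ w → g (g⁻ w) ≡ w
            gg⁻ = λ w → proj₂ (surj w)
            g⁻g : ∀ x → g⁻ (g x) ≡ x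
            g⁻g = λ x → inj _ _ (gg⁻ (g x))
        in g⁻
         , ( ( (λ x y e → trans (sym (gg⁻ x)) (trans (cong g e) (gg⁻ y)))
             , (λ w → g w , g⁻g w)
             , (λ x y → trans (sym (hom _ _)) (cong₂ a (gg⁻ x) (gg⁻ y))))
           , (λ x y → trans (sym (pres _ _)) (cong₂ ω (gg⁻ x) (gg⁻ y))))
         , g⁻g
    }

  open IsSubgroupOfAut subgroup

  lift : (Fin m → Fin m) → Fin n → Fin n
  lift π = φ⁻ ∘ π ∘ φ

  -- Adjacency is the symmetric closure of the orientation, so preserving the latter preserves the
  -- former.
  lift-∈G : ∀ π → (∀ i j → π i ≡ π j → i ≡ j) → (∀ j → ∃ λ i → π i ≡ j) →
            (∀ i j → o (π i) (π j) ≡ o i j) → G (lift π)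
  lift-∈G π inj surj pres =
    ( (λ x y e → φ-injective (inj _ _ (φ⁻-injective e)))
    , (λ w → let (i , πi) = surj (φ w) in φ⁻ i , trans (cong φ⁻ (trans (cong π (φφ⁻ i)) πi)) (φ⁻φ w))
    , (λ x y → trans (ω-adj _ _) (trans (cong₂ _∨_ (pres′ x y) (pres′ y x)) (sym (ω-adj x y)))))
    , pres′
    where
    φ-injective : ∀ {x y} → φ x ≡ φ y → x ≡ y
    φ-injective e = trans (sym (φ⁻φ _)) (trans (cong φ⁻ e) (φ⁻φ _))
    φ⁻-injective : ∀ {i j} → φ⁻ i ≡ φ⁻ j → i ≡ j
    φ⁻-injective e = trans (sym (φφ⁻ _)) (trans (cong φ e) (φφ⁻ _))
    pres′ : ∀ x y → ω (lift π x) (lift π y) ≡ ω x y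
    pres′ x y = trans (cong₂ o (φφ⁻ _) (φφ⁻ _)) (pres _ _)

  γ : Fin 3 → Fin n → Fin n
  γ r = lift (gen r)

  γ-φ⁻ : ∀ r k i → iterate (γ r) k (φ⁻ i) ≡ φ⁻ (iterate (gen r) k i)
  γ-φ⁻ r zero    i = refl
  γ-φ⁻ r (suc k) i = trans (cong (γ r) (γ-φ⁻ r k i)) (cong (φ⁻ ∘ gen r) (φφ⁻ _))

  γ-∈G : ∀ r k → G (iterate (γ r) k)
  γ-∈G r zero    = has-id
  γ-∈G r (suc k) = comp _ _ (lift-∈G (gen r) (gen-inj r) (gen-surj r) (gen-pres r)) (γ-∈G r k)

  from-base : ∀ {x y} → ω x y ≡ true → ∃ λ g → G g × g (φ⁻ p) ≡ x × g (φ⁻ q) ≡ y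
  from-base {x} {y} xy with arc-transitive (φ x) (φ y) xy
  ... | k , l , s , px , qy = g
      , comp _ _ (γ-∈G zero (toℕ k)) (comp _ _ (γ-∈G (suc zero) (toℕ l)) (γ-∈G (suc (suc zero)) (toℕ s)))
      , trans (g-φ⁻ p) (trans (cong φ⁻ px) (φ⁻φ x))
      , trans (g-φ⁻ q) (trans (cong φ⁻ qy) (φ⁻φ y))
    where
    g : Fin n → Fin n
    g = iterate (γ zero) (toℕ k) ∘ (iterate (γ (suc zero)) (toℕ l) ∘ iterate (γ (suc (suc zero))) (toℕ s))
    g-φ⁻ : ∀ i → g (φ⁻ i) ≡ φ⁻ (word (toℕ k) (toℕ l) (toℕ s) i)
    g-φ⁻ i = trans (cong (iterate (γ zero) (toℕ k)) (trans (cong (iterate (γ (suc zero)) (toℕ l))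
               (γ-φ⁻ (suc (suc zero)) (toℕ s) i)) (γ-φ⁻ (suc zero) (toℕ l) _))) (γ-φ⁻ zero (toℕ k) _)

  moves : ∀ {x y x′ y′} → ω x y ≡ true → ω x′ y′ ≡ true → ∃ λ g → G g × g x ≡ x′ × g y ≡ y′
  moves xy xy′ with from-base xy | from-base xy′
  ... | g , Gg , refl , refl | h , Gh , refl , refl with inv g Gg
  ...   | g⁻ , Gg⁻ , g⁻g = h ∘ g⁻ , comp h g⁻ Gh Gg⁻ , cong h (g⁻g _) , cong h (g⁻g _)

  ω-total : ∀ {x y} → Adj Γ x y → ω x y ≡ true ⊎ ω y x ≡ true
  ω-total {x} {y} xy with ω x y | ω y x | trans (sym (ω-adj x y)) xy
  ... | true  | _    | _ = inj₁ refl
  ... | false | true | _ = inj₂ refl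

  -- Every vertex is the tail of an oriented arc, so transitivity on those arcs is enough.
  vertex-transitive : VertexTransitive Γ G
  vertex-transitive x y with successor (φ x) | successor (φ y)
  ... | i , xi | j , yj with moves {x} {φ⁻ i} {y} {φ⁻ j} (trans (cong (o (φ x)) (φφ⁻ i)) xi) (trans (cong (o (φ y)) (φφ⁻ j)) yj)
  ...   | g , Gg , gx , _ = g , Gg , gx

  edge-transitive : EdgeTransitive Γ G
  edge-transitive x y x′ y′ xy xy′ with ω-total xy | ω-total xy′
  ... | inj₁ d | inj₁ d′ = let (g , Gg , e , f) = moves d d′ in g , Gg , inj₁ (e , f)
  ... | inj₁ d | inj₂ d′ = let (g , Gg , e , f) = moves d d′ in g , Gg , inj₂ (e , f)
  ... | inj₂ d | inj₁ d′ = let (g , Gg , e , f) = moves d d′ in g , Gg , inj₂ (f , e)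
  ... | inj₂ d | inj₂ d′ = let (g , Gg , e , f) = moves d d′ in g , Gg , inj₁ (f , e)

  u v : Fin n
  u = φ⁻ p
  v = φ⁻ q

  ω-uv : ω u v ≡ true
  ω-uv = trans (cong₂ o (φφ⁻ p) (φφ⁻ q)) pq

  uv : Adj Γ u v
  uv = trans (ω-adj u v) (cong (_∨ ω v u) ω-uv)

  vu : Adj Γ v u
  vu = trans (ω-adj v u) (trans (Bool.∨-comm (ω v u) (ω u v)) (cong (_∨ ω v u) ω-uv))

  -- An element reversing `(u , v)` would carry its orientation to `(v , u)`, against antisymmetry.
  not-arc-transitive : ¬ ArcTransitive Γ G
  not-arc-transitive at with at u v v u uv vu
  ... | g , (_ , pres) , gu , gv
    with trans (sym (antisym (φ u) (φ v))) (cong₂ _∧_ ω-uv (trans (cong₂ ω (sym gu) (sym gv)) (trans (pres u v) ω-uv)))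
  ... | ()

  orbit⇒ω : ∀ {x y} → ArcOrbit Γ G u v x y → ω x y ≡ true
  orbit⇒ω (g , (_ , pres) , refl , refl) = trans (pres u v) ω-uv

  pulled-back : Cycle Γ 5
  pulled-back = φ⁻ ∘ cycle
    , (λ i j e → cycle-inj i j (trans (sym (φφ⁻ _)) (trans (cong φ e) (φφ⁻ _))))
    , (λ i → trans (sym (φ-adj _ _)) (trans (cong₂ matrix (φφ⁻ _) (φφ⁻ _)) (cycle-edges i)))

  -- In either direction, a directed cycle has an arc leaving each of its vertices, but none leaves
  -- the sink.
  undirected : UndirectedCycle Γ (ArcOrbit Γ G u v) pulled-back
  undirected directed with directed sink
  ... | inj₁ (_ , out) with trans (sym sink-out) (trans (sym (cong₂ o (φφ⁻ _) (φφ⁻ _))) (orbit⇒ω out))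
  ...   | ()
  undirected directed | inj₂ (out , _) with trans (sym sink-in) (trans (sym (cong₂ o (φφ⁻ _) (φφ⁻ _))) (orbit⇒ω out))
  ...   | ()

  half-arc-transitive-group : Σ ((Fin n → Fin n) → Set) (λ G → HalfArcTransitive Γ G ×
    ∃ (λ u → ∃ (λ v → Adj Γ u v × Σ (Cycle Γ 5) (λ C → UndirectedCycle Γ (ArcOrbit Γ G u v) C))))
  half-arc-transitive-group = G , (subgroup , vertex-transitive , edge-transitive , not-arc-transitive)
    , u , v , uv , pulled-back , undirected

-- Explicit symmetries of the two graphs, verified by finite search

permutation : ∀ m .{{_ : ℕ.NonZero m}} → (Name → Name) → Fin m → Fin m
permutation m f i = f (toℕ i) mod m

module Decide {m : ℕ} (b : Fin m → Fin m → Bool) (D : SymmetryData m) where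

  open SymmetryData D

  union?          = Fin.all? λ i → Fin.all? λ j → b i j Bool.≟ o i j ∨ o j i
  antisym?        = Fin.all? λ i → Fin.all? λ j → o i j ∧ o j i Bool.≟ false
  gen-inj?        = Fin.all? λ r → Fin.all? λ i → Fin.all? λ j → (gen r i Fin.≟ gen r j) →-dec (i Fin.≟ j)
  gen-surj?       = Fin.all? λ r → Fin.all? λ j → Fin.any? λ i → gen r i Fin.≟ j
  gen-pres?       = Fin.all? λ r → Fin.all? λ i → Fin.all? λ j → o (gen r i) (gen r j) Bool.≟ o i j
  successor?      = Fin.all? λ i → Fin.any? λ j → o i j Bool.≟ true
  arc-transitive? = Fin.all? λ i → Fin.all? λ j → (o i j Bool.≟ true) →-dec
    (Fin.any? {12} λ k → Fin.any? {3} λ l → Fin.any? {2} λ s →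
      (word (toℕ k) (toℕ l) (toℕ s) p Fin.≟ i) ×-dec (word (toℕ k) (toℕ l) (toℕ s) q Fin.≟ j))
  cycle-inj?      = Fin.all? λ i → Fin.all? λ j → (cycle i Fin.≟ cycle j) →-dec (i Fin.≟ j)
  cycle-edges?    = Fin.all? λ i → b (cycle i) (cycle (next (FinGraph m b) i)) Bool.≟ true

doyleHoltData : SymmetryData 27
doyleHoltData = record
  { o     = λ i j → elem (toℕ j) (outs doyleHoltArcs (toℕ i))
  ; gen   = λ r → permutation 27 (lookup (rotation ∷ shift ∷ negation ∷ []) r)
  ; p     = 0 mod 27
  ; q     = 10 mod 27
  -- From u_0^0 the superscript changes by 1, 4, 2, 1, in total 8, which is -1 modulo 9; so the path
  -- ends at the other successor u_1^8 of u_0^0, the sink.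
  ; cycle = lookup (map (_mod 27) (0 ∷ 10 ∷ 23 ∷ 7 ∷ 17 ∷ []))
  ; sink  = suc (suc (suc zero)) }
  where
  -- Multiplication by 4 turns the steps ±4^i into ±4^(i+1), consistently around the three layers
  -- since 4^3 is 1 modulo 9; the factor 8 is -1 and exchanges the two signs.
  rotation shift negation : Name → Name
  rotation k = 9 * (k / 9) + (k % 9 + 1) % 9
  shift    k = 9 * ((k / 9 + 1) % 3) + (4 * k) % 9
  negation k = 9 * (k / 9) + (8 * k) % 9

doyleHolt-symmetries : Symmetries (Enumeration.matrix doyleHoltEnum) doyleHoltData
doyleHolt-symmetries = record
  { edges = from-yes union? ; antisym = from-yes antisym?
  ; gen-inj = from-yes gen-inj? ; gen-surj = from-yes gen-surj? ; gen-pres = from-yes gen-pres?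
  ; successor = from-yes successor? ; arc-transitive = from-yes arc-transitive? ; pq = refl
  ; cycle-inj = from-yes cycle-inj? ; cycle-edges = from-yes cycle-edges? ; sink-in = refl ; sink-out = refl }
  where open Decide (Enumeration.matrix doyleHoltEnum) doyleHoltData

roseData : SymmetryData 24
roseData = record
  { o     = λ i j → elem (toℕ j) (outs roseArcs (toℕ i))
  ; gen   = λ r → permutation 24 (lookup (rotation ∷ nth σ ∷ nth τ ∷ []) r)
  ; p     = 0 mod 24
  ; q     = 1 mod 24
  -- The directed path x_0, x_1, x_2, y_2, y_0 together with the arc from x_0 to y_0, which is the
  -- sink.
  ; cycle = lookup (map (_mod 24) (0 ∷ 1 ∷ 2 ∷ 14 ∷ 12 ∷ []))
  ; sink  = suc (suc (suc zero)) }
  where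
  rotation : Name → Name
  rotation k = 12 * (k / 12) + (k % 12 + 1) % 12
  -- Rotation has four orbits on arcs, according to the letters x and y of the ends. The involution
  -- `σ` takes `(x_0 , x_1)` to `(x_0 , y_0)`, the involution `τ` takes it to `(y_2 , x_7)`, and `τ`
  -- followed by `σ` to `(y_8 , y_6)`: one arc in each orbit.
  σ τ : List Name
  σ = 0 ∷ 12 ∷ 22 ∷ 3 ∷ 15 ∷ 13 ∷ 6 ∷ 18 ∷ 16 ∷ 9 ∷ 21 ∷ 19 ∷
      1 ∷ 5 ∷ 20 ∷ 4 ∷ 8 ∷ 23 ∷ 7 ∷ 11 ∷ 14 ∷ 10 ∷ 2 ∷ 17 ∷ []
  τ = 14 ∷ 7 ∷ 19 ∷ 17 ∷ 10 ∷ 22 ∷ 20 ∷ 1 ∷ 13 ∷ 23 ∷ 4 ∷ 16 ∷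
      12 ∷ 8 ∷ 0 ∷ 15 ∷ 11 ∷ 3 ∷ 18 ∷ 2 ∷ 6 ∷ 21 ∷ 5 ∷ 9 ∷ []

rose-symmetries : Symmetries (Enumeration.matrix roseEnum) roseData
rose-symmetries = record
  { edges = from-yes union? ; antisym = from-yes antisym?
  ; gen-inj = from-yes gen-inj? ; gen-surj = from-yes gen-surj? ; gen-pres = from-yes gen-pres?
  ; successor = from-yes successor? ; arc-transitive = from-yes arc-transitive? ; pq = refl
  ; cycle-inj = from-yes cycle-inj? ; cycle-edges = from-yes cycle-edges? ; sink-in = refl ; sink-out = refl }
  where open Decide (Enumeration.matrix roseEnum) roseData

theorem5p5 : (n : ℕ) (a : Fin n → Fin n → Bool) →
    let Γ = FinGraph n a in
    IsSimple Γ → Connected Γ → Tetravalent Γ → Girth5 Γ →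
    (Σ ((Fin n → Fin n) → Set) (λ G → HalfArcTransitive Γ G ×
    ∃ (λ u → ∃ (λ v → Adj Γ u v ×
    Σ (Cycle Γ 5) (λ C → UndirectedCycle Γ (ArcOrbit Γ G u v) C)))))
    ⇔ ((Γ ≅ Xo 3 9 4) ⊎ (Γ ≅ Rose 12 5 2))
theorem5p5 n a simple connected tetravalent (_ , no₃ , no₄) = mk⇔
  (λ (G , hat , u , v , uv , C , undirected) →
    Classification.undirected⇒goal n a simple connected tetravalent no₃ no₄ G hat u v uv C undirected)
  λ { (inj₁ iso) → Converse.half-arc-transitive-group n a doyleHoltEnum doyleHolt-symmetries iso
    ; (inj₂ iso) → Converse.half-arc-transitive-group n a roseEnum rose-symmetries iso }
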